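{- Suppose $0< \alpha < \beta \leq 1$ are rational numbers. Then $\mathrm{SC}(\lambda n.\, n^\alpha) \leq_{\mathrm{s}} \mathrm{COMPLEX}(\lambda n.\, n^\beta)$.
   Context: Prefix-free complexity: a prefix-free machine is a partial recursive $M$ from $\{0,1\}^*$ to $\{0,1\}^*$ with prefix-free domain; $U$ is universal if for each prefix-free machine $M$ there is $\rho$ with $U(\rho^\frown\tau)\simeq M(\tau)$ for all $\tau$. Fix a universal $U$ and let $K(\sigma)=\min\{|\tau| : U(\tau)=\sigma\}$. For $f\colon\mathbb{N}\to\mathbb{R}$, $\mathrm{COMPLEX}(f)$ is the set of $X\in\{0,1\}^{\mathbb{N}}$ for which there is $c\in\mathbb{N}$ with $K(X\upharpoonright n)\geq f(n)-c$ for all $n$; $\mathrm{SC}(f)$ is the set of $X\in\{0,1\}^{\mathbb{N}}$ for which there is $c\in\mathbb{N}$ with $K(\tau)\geq f(|\tau|)-c$ for every (contiguous, finite) substring $\tau$ of $X$. For $P,Q\subseteq\mathbb{N}^{\mathbb{N}}$, $P\leq_{\mathrm{s}}Q$ means there is a partial recursive functional defined on all of $Q$ that maps $Q$ into $P$. -}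

module Defs where

open import Data.Bool.Base using (Bool; true; false)
open import Data.Fin.Base using (Fin)
open import Data.Integer.Base as ℤ using (+_; ∣_∣)
open import Data.List.Base using (List; []; _∷_; _++_; length; applyUpTo)
open import Data.Nat.Base as ℕ using (ℕ; zero; suc)
open import Data.Product.Base using (∃-syntax; Σ-syntax; _×_; _,_)
open import Data.Rational.Base as ℚ using (ℚ; 0ℚ; 1ℚ; _/_; ↥_; ↧ₙ_)
import Data.Rational.Properties as ℚ
open import Algebra.Definitions.RawSemiring ℚ.+-*-rawSemiring using () renaming (_^_ to _^ℚ_)
open import Data.Sum.Base using (_⊎_; inj₁; inj₂)
open import Data.Vec.Base using (Vec; []; _∷_; lookup)
open import Data.Vec.Relation.Binary.Pointwise.Inductive using (Pointwise)
open import Function.Bundles using (_⇔_; mk⇔; module Equivalence)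
open import Level using (0ℓ)
open import Relation.Binary.PropositionalEquality using (_≡_; refl; sym; trans; cong; subst)
open import Relation.Nullary using (¬_; yes; no)
open import Relation.Unary using (Pred; _∈_)

record ℝ : Set₁ where
  field
    L U           : Pred ℚ 0ℓ
    L-inhabited   : ∃[ r ] L r
    U-inhabited   : ∃[ r ] U r
    L-rounded     : ∀ r → L r ⇔ (∃[ s ] r ℚ.< s × L s)
    U-rounded     : ∀ r → U r ⇔ (∃[ s ] s ℚ.< r × U s)
    disjoint      : ∀ r → ¬ (L r × U r)
    located       : ∀ {r s} → r ℚ.< s → L r ⊎ U s

open ℝ using (L)

infix 4 _≤ℝ_
_≤ℝ_ : ℝ → ℝ → Set
x ≤ℝ y = ∀ r → L x r → L y r

fromℚ : ℚ → ℝ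
fromℚ q = record
  { L           = ℚ._< q
  ; U           = q ℚ.<_
  ; L-inhabited = q ℚ.- 1ℚ , subst (q ℚ.- 1ℚ ℚ.<_) (ℚ.+-identityʳ q) (ℚ.+-monoʳ-< q (ℚ.negative⁻¹ (ℚ.- 1ℚ)))
  ; U-inhabited = q ℚ.+ 1ℚ , subst (ℚ._< q ℚ.+ 1ℚ) (ℚ.+-identityʳ q) (ℚ.+-monoʳ-< q (ℚ.positive⁻¹ 1ℚ))
  ; L-rounded   = λ r → mk⇔ ℚ.<-dense (λ (s , r<s , s<q) → ℚ.<-trans r<s s<q)
  ; U-rounded   = λ r → mk⇔ (λ q<r → let s , q<s , s<r = ℚ.<-dense q<r in s , s<r , q<s)
                            (λ (s , s<r , q<s) → ℚ.<-trans q<s s<r)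
  ; disjoint    = λ r (r<q , q<r) → ℚ.<-asym r<q q<r
  ; located     = located
  }
  where
  located : ∀ {r s} → r ℚ.< s → r ℚ.< q ⊎ q ℚ.< s
  located {r} {s} r<s with r ℚ.<? q
  ... | yes r<q = inj₁ r<q
  ... | no  r≮q = inj₂ (ℚ.≤-<-trans (ℚ.≮⇒≥ r≮q) r<s)

fromℕ : ℕ → ℝ
fromℕ n = fromℚ (+ n / 1)

infixl 6 _-ℝ_
_-ℝ_ : ℝ → ℚ → ℝ
x -ℝ q = record
  { L           = λ r → X.L (r ℚ.+ q)
  ; U           = λ r → X.U (r ℚ.+ q)
  ; L-inhabited = let r , Lr = X.L-inhabited in r ℚ.- q , subst X.L (sym (cancel r)) Lr
  ; U-inhabited = let r , Ur = X.U-inhabited in r ℚ.- q , subst X.U (sym (cancel r)) Ur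
  ; L-rounded   = λ r → mk⇔
      (λ Lr → let s , r<s , Ls = to (X.L-rounded (r ℚ.+ q)) Lr in
        s ℚ.- q , ℚ.≤-<-trans (ℚ.≤-reflexive (sym (cancel′ r))) (ℚ.+-monoˡ-< (ℚ.- q) r<s)
                , subst X.L (sym (cancel s)) Ls)
      (λ (s , r<s , Ls) → from (X.L-rounded (r ℚ.+ q)) (s ℚ.+ q , ℚ.+-monoˡ-< q r<s , Ls))
  ; U-rounded   = λ r → mk⇔
      (λ Ur → let s , s<r , Us = to (X.U-rounded (r ℚ.+ q)) Ur in
        s ℚ.- q , ℚ.<-≤-trans (ℚ.+-monoˡ-< (ℚ.- q) s<r) (ℚ.≤-reflexive (cancel′ r))
                , subst X.U (sym (cancel s)) Us)
      (λ (s , s<r , Us) → from (X.U-rounded (r ℚ.+ q)) (s ℚ.+ q , ℚ.+-monoˡ-< q s<r , Us))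
  ; disjoint    = λ r → X.disjoint (r ℚ.+ q)
  ; located     = λ r<s → X.located (ℚ.+-monoˡ-< q r<s)
  }
  where
  module X = ℝ x
  open Equivalence using (to; from)

  cancel : ∀ r → (r ℚ.- q) ℚ.+ q ≡ r
  cancel r = trans (ℚ.+-assoc r (ℚ.- q) q)
                   (trans (cong (r ℚ.+_) (ℚ.+-inverseˡ q)) (ℚ.+-identityʳ r))

  cancel′ : ∀ r → (r ℚ.+ q) ℚ.- q ≡ r
  cancel′ r = trans (ℚ.+-assoc r q (ℚ.- q))
                    (trans (cong (r ℚ.+_) (ℚ.+-inverseʳ q)) (ℚ.+-identityʳ r))

nonNeg-* : ∀ {x y} → 0ℚ ℚ.≤ x → 0ℚ ℚ.≤ y → 0ℚ ℚ.≤ x ℚ.* y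
nonNeg-* {x} {y} 0≤x 0≤y =
  ℚ.nonNegative⁻¹ _ {{ℚ.nonNeg*nonNeg⇒nonNeg x {{ℚ.nonNegative 0≤x}} y {{ℚ.nonNegative 0≤y}}}}

^-nonNeg : ∀ {x} → 0ℚ ℚ.≤ x → ∀ k → 0ℚ ℚ.≤ x ^ℚ k
^-nonNeg 0≤x zero    = ℚ.nonNegative⁻¹ 1ℚ
^-nonNeg 0≤x (suc k) = nonNeg-* 0≤x (^-nonNeg 0≤x k)

^-mono-≤ : ∀ {x y} → 0ℚ ℚ.≤ x → x ℚ.≤ y → ∀ k → x ^ℚ k ℚ.≤ y ^ℚ k
^-mono-≤ 0≤x x≤y zero = ℚ.≤-refl
^-mono-≤ {x} {y} 0≤x x≤y (suc k) = ℚ.≤-trans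
  (ℚ.*-monoʳ-≤-nonNeg (x ^ℚ k) {{ℚ.nonNegative (^-nonNeg 0≤x k)}} x≤y)
  (ℚ.*-monoˡ-≤-nonNeg y {{ℚ.nonNegative (ℚ.≤-trans 0≤x x≤y)}} (^-mono-≤ 0≤x x≤y k))

^-pos : ∀ {x} → 0ℚ ℚ.< x → ∀ k → 0ℚ ℚ.< x ^ℚ k
^-pos 0<x zero = ℚ.positive⁻¹ 1ℚ
^-pos {x} 0<x (suc k) =
  ℚ.positive⁻¹ _ {{ℚ.pos*pos⇒pos x {{ℚ.positive 0<x}} (x ^ℚ k) {{ℚ.positive (^-pos 0<x k)}}}}

^-mono-< : ∀ {x y} → 0ℚ ℚ.≤ x → x ℚ.< y → ∀ k → x ^ℚ suc k ℚ.< y ^ℚ suc k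
^-mono-< {x} {y} 0≤x x<y k = ℚ.≤-<-trans
  (ℚ.*-monoˡ-≤-nonNeg x {{ℚ.nonNegative 0≤x}} (^-mono-≤ 0≤x (ℚ.<⇒≤ x<y) k))
  (ℚ.*-monoˡ-<-pos (y ^ℚ k) {{ℚ.positive (^-pos (ℚ.≤-<-trans 0≤x x<y) k)}} x<y)

1≤^ : ∀ {x} → 1ℚ ℚ.≤ x → ∀ k → 1ℚ ℚ.≤ x ^ℚ k
1≤^ 1≤x zero = ℚ.≤-refl
1≤^ {x} 1≤x (suc k) = ℚ.≤-trans 1≤x (ℚ.≤-trans
  (ℚ.≤-reflexive (sym (ℚ.*-identityʳ x)))
  (ℚ.*-monoˡ-≤-nonNeg x {{ℚ.nonNegative (ℚ.≤-trans (ℚ.nonNegative⁻¹ 1ℚ) 1≤x)}} (1≤^ 1≤x k)))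

x≤x^ : ∀ {x} → 1ℚ ℚ.≤ x → ∀ k → x ℚ.≤ x ^ℚ suc k
x≤x^ {x} 1≤x k = ℚ.≤-trans
  (ℚ.≤-reflexive (sym (ℚ.*-identityʳ x)))
  (ℚ.*-monoˡ-≤-nonNeg x {{ℚ.nonNegative (ℚ.≤-trans (ℚ.nonNegative⁻¹ 1ℚ) 1≤x)}} (1≤^ 1≤x k))

0≤+n/1 : ∀ n → 0ℚ ℚ.≤ + n / 1
0≤+n/1 n = ℚ.nonNegative⁻¹ _ {{ℚ.normalize-nonNeg n 1}}

-- The q-th root of N, as the supremum of { s : s < 0 or s^q ≤ N } and the
-- infimum of { s ≥ 0 : N ≤ s^q }.
root : (q : ℕ) .{{_ : ℕ.NonZero q}} → ℕ → ℝ
root q@(suc k) N = record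
  { L           = Lo
  ; U           = Up
  ; L-inhabited = ℚ.- 1ℚ , 0ℚ , ℚ.negative⁻¹ (ℚ.- 1ℚ)
                , inj₂ (ℚ.≤-trans (ℚ.≤-reflexive (ℚ.*-zeroˡ (0ℚ ^ℚ k))) (0≤+n/1 N))
  ; U-inhabited = let M = 1ℚ ℚ.+ N′ in M ℚ.+ 1ℚ , M
                , subst (ℚ._< M ℚ.+ 1ℚ) (ℚ.+-identityʳ M) (ℚ.+-monoʳ-< M (ℚ.positive⁻¹ 1ℚ))
                , ℚ.≤-trans (0≤+n/1 N) N≤1+N
                , ℚ.≤-trans N≤1+N (x≤x^ 1≤1+N k)
  ; L-rounded   = λ r → mk⇔
      (λ (s , r<s , p) → let t , r<t , t<s = ℚ.<-dense r<s in t , r<t , s , t<s , p)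
      (λ (t , r<t , s , t<s , p) → s , ℚ.<-trans r<t t<s , p)
  ; U-rounded   = λ r → mk⇔
      (λ (s , s<r , p) → let t , s<t , t<r = ℚ.<-dense s<r in t , t<r , s , s<t , p)
      (λ (t , t<r , s , s<t , p) → s , ℚ.<-trans s<t t<r , p)
  ; disjoint    = λ where
      r ((s , r<s , inj₁ s<0) , (t , t<r , 0≤t , _)) →
        ℚ.<-irrefl refl (ℚ.≤-<-trans 0≤t (ℚ.<-trans t<r (ℚ.<-trans r<s s<0)))
      r ((s , r<s , inj₂ s^q≤N) , (t , t<r , 0≤t , N≤t^q)) →
        ℚ.<-irrefl refl (ℚ.<-≤-trans (^-mono-< 0≤t (ℚ.<-trans t<r r<s) k) (ℚ.≤-trans s^q≤N N≤t^q))
  ; located     = located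
  }
  where
  N′ : ℚ
  N′ = + N / 1

  Lo Up : Pred ℚ 0ℓ
  Lo r = ∃[ s ] r ℚ.< s × (s ℚ.< 0ℚ ⊎ s ^ℚ q ℚ.≤ N′)
  Up r = ∃[ s ] s ℚ.< r × 0ℚ ℚ.≤ s × N′ ℚ.≤ s ^ℚ q

  N≤1+N : N′ ℚ.≤ 1ℚ ℚ.+ N′
  N≤1+N = subst (ℚ._≤ 1ℚ ℚ.+ N′) (ℚ.+-identityˡ N′) (ℚ.+-monoˡ-≤ N′ (ℚ.nonNegative⁻¹ 1ℚ))

  1≤1+N : 1ℚ ℚ.≤ 1ℚ ℚ.+ N′
  1≤1+N = subst (ℚ._≤ 1ℚ ℚ.+ N′) (ℚ.+-identityʳ 1ℚ) (ℚ.+-monoʳ-≤ 1ℚ (0≤+n/1 N))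

  located : ∀ {r s} → r ℚ.< s → Lo r ⊎ Up s
  located r<s with ℚ.<-dense r<s
  ... | t , r<t , t<s with t ℚ.<? 0ℚ | ℚ.≤-total (t ^ℚ q) N′
  ...   | yes t<0 | _          = inj₁ (t , r<t , inj₁ t<0)
  ...   | no  _   | inj₁ t^q≤N = inj₁ (t , r<t , inj₂ t^q≤N)
  ...   | no  t≮0 | inj₂ N≤t^q = inj₂ (t , t<s , ℚ.≮⇒≥ t≮0 , N≤t^q)

-- Taking the absolute value of the numerator is harmless, as α is positive.
infixr 8 _^ᵠ_[_]
_^ᵠ_[_] : ℕ → (α : ℚ) → 0ℚ ℚ.< α → ℝ
n ^ᵠ α [ _ ] = root (↧ₙ α) (n ℕ.^ ∣ ↥ α ∣)

-- μ-recursive functions relative to k oracles; with k = 0 these are the partial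
-- recursive functions, with k = 1 the partial recursive functionals on ℕ^ℕ.
data Code (k : ℕ) : ℕ → Set where
  zero   : ∀ {n} → Code k n
  succ   : Code k 1
  proj   : ∀ {n} → Fin n → Code k n
  oracle : Fin k → Code k 1
  comp   : ∀ {m n} → Code k m → Vec (Code k n) m → Code k n
  prec   : ∀ {n} → Code k n → Code k (2 ℕ.+ n) → Code k (1 ℕ.+ n)
  mu     : ∀ {n} → Code k (1 ℕ.+ n) → Code k n

infix 4 _⊢_[_]⇓_
data _⊢_[_]⇓_ {k} (Ξ : Fin k → ℕ → ℕ) : ∀ {n} → Code k n → Vec ℕ n → ℕ → Set where
  zero      : ∀ {n} {xs : Vec ℕ n} → Ξ ⊢ zero [ xs ]⇓ 0
  succ      : ∀ {x} → Ξ ⊢ succ [ x ∷ [] ]⇓ suc x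
  proj      : ∀ {n} {xs : Vec ℕ n} i → Ξ ⊢ proj i [ xs ]⇓ lookup xs i
  oracle    : ∀ {x} i → Ξ ⊢ oracle i [ x ∷ [] ]⇓ Ξ i x
  comp      : ∀ {m n} {f : Code k m} {gs : Vec (Code k n) m} {xs ys z} →
              Pointwise (λ g y → Ξ ⊢ g [ xs ]⇓ y) gs ys →
              Ξ ⊢ f [ ys ]⇓ z →
              Ξ ⊢ comp f gs [ xs ]⇓ z
  prec-zero : ∀ {n} {f : Code k n} {g xs y} →
              Ξ ⊢ f [ xs ]⇓ y →
              Ξ ⊢ prec f g [ 0 ∷ xs ]⇓ y
  prec-suc  : ∀ {n} {f : Code k n} {g x xs y z} →
              Ξ ⊢ prec f g [ x ∷ xs ]⇓ y →
              Ξ ⊢ g [ x ∷ y ∷ xs ]⇓ z →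
              Ξ ⊢ prec f g [ suc x ∷ xs ]⇓ z
  mu        : ∀ {n} {f : Code k (1 ℕ.+ n)} {xs y} →
              (∀ i → i ℕ.< y → ∃[ z ] Ξ ⊢ f [ i ∷ xs ]⇓ suc z) →
              Ξ ⊢ f [ y ∷ xs ]⇓ 0 →
              Ξ ⊢ mu f [ xs ]⇓ y

-- Bijective base-2 numeration, least significant digit first: a bijection
-- from finite binary strings to ℕ.
encode : List Bool → ℕ
encode []          = 0
encode (false ∷ σ) = 1 ℕ.+ 2 ℕ.* encode σ
encode (true  ∷ σ) = 2 ℕ.+ 2 ℕ.* encode σ

Machine : Set
Machine = Code 0 1

no-oracles : Fin 0 → ℕ → ℕ
no-oracles ()

infix 4 _⟨_⟩≃_
_⟨_⟩≃_ : Machine → List Bool → List Bool → Set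
M ⟨ σ ⟩≃ τ = no-oracles ⊢ M [ encode σ ∷ [] ]⇓ encode τ

dom : Machine → Pred (List Bool) 0ℓ
dom M σ = ∃[ τ ] M ⟨ σ ⟩≃ τ

PrefixFree : Machine → Set
PrefixFree M = ∀ σ τ → σ ∈ dom M → σ ++ τ ∈ dom M → τ ≡ []

record Universal (U : Machine) : Set where
  field
    prefixFree : PrefixFree U
    universal  : ∀ M → PrefixFree M →
                 ∃[ ρ ] ∀ τ σ → (U ⟨ ρ ++ τ ⟩≃ σ) ⇔ (M ⟨ τ ⟩≃ σ)

-- K U σ k : k is the minimum of { |τ| : U(τ) = σ }.  As K is not computable,
-- it is given by its graph.
K : Machine → List Bool → ℕ → Set
K U σ k = (∃[ τ ] U ⟨ τ ⟩≃ σ × length τ ≡ k)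
        × (∀ τ → U ⟨ τ ⟩≃ σ → k ℕ.≤ length τ)

infix 4 K[_,_]≥_
K[_,_]≥_ : Machine → List Bool → ℝ → Set
K[ U , σ ]≥ x = ∀ k → K U σ k → x ≤ℝ fromℕ k

infixl 7 _↾_
_↾_ : (ℕ → Bool) → ℕ → List Bool
X ↾ n = applyUpTo X n

infix 4 _substringOf_
_substringOf_ : List Bool → (ℕ → Bool) → Set
τ substringOf X = ∃[ i ] τ ≡ (λ j → X (i ℕ.+ j)) ↾ length τ

COMPLEX : Machine → (ℕ → ℝ) → Pred (ℕ → Bool) 0ℓ
COMPLEX U f X = Σ[ c ∈ ℕ ] ∀ n → K[ U , X ↾ n ]≥ (f n -ℝ (+ c / 1))

SC : Machine → (ℕ → ℝ) → Pred (ℕ → Bool) 0ℓ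
SC U f X = Σ[ c ∈ ℕ ] ∀ τ → τ substringOf X → K[ U , τ ]≥ (f (length τ) -ℝ (+ c / 1))

bit : Bool → ℕ
bit false = 0
bit true  = 1

asBaire : Pred (ℕ → Bool) 0ℓ → Pred (ℕ → ℕ) 0ℓ
asBaire P X = ∃[ Z ] (∀ n → X n ≡ bit (Z n)) × Z ∈ P

-- The partial recursive functional given by Φ is defined at X with value Y
-- when Φ with oracle X computes the total function Y.
infix 4 _≤ₛ_
_≤ₛ_ : Pred (ℕ → ℕ) 0ℓ → Pred (ℕ → ℕ) 0ℓ → Set
P ≤ₛ Q = ∃[ Φ ] ∀ X → X ∈ Q →
         ∃[ Y ] (∀ n → (λ (_ : Fin 1) → X) ⊢ Φ [ n ∷ [] ]⇓ Y n) × Y ∈ P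

{-# OPTIONS --safe #-}
-- Write n + 1 = 2^k (2 j + 1) and put Y(n) = X(j mod 2^(C k)).  The positions of
-- level k are 2^(k+1) apart and carry X ↾ 2^(C k) periodically, so every window
-- of Y of length 2^((C+1) k + 1) contains X ↾ 2^(C k), and its bits are found
-- from the window's offset modulo that length.  A prefix-free machine reading
-- 0^k 1, then the (C+1) k + 1 bits of the offset, then a description of the
-- window τ, shows K(X ↾ 2^(C k)) ≤ K(τ) + O(k).  When C / (C + 1) is close
-- enough to 1, this and K(X ↾ m) ≥ m^β - c force K(τ) ≥ |τ|^α - c′.
module Submission where

open import Defs
open import Data.Bool.Base using (Bool; true; false)
open import Data.Fin.Base using (Fin; zero; suc)
open import Data.Integer.Base as ℤ using (+_)
import Data.Integer.Properties as ℤ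
open import Data.List.Base using (List; []; _∷_; _++_; _∷ʳ_; length; replicate; applyUpTo; take; drop)
open import Data.List.Properties using (++-assoc; length-++; length-replicate; length-applyUpTo; applyUpTo-∷ʳ; take++drop≡id; length-take)
open import Data.Nat.Base as ℕ using (ℕ; zero; suc; NonZero; z≤n; s≤s)
open import Data.Nat.Coprimality using (1-coprimeTo) renaming (sym to coprime-sym)
open import Data.Nat.DivMod
open import Data.Nat.Induction using (<-wellFounded)
open import Data.Nat.Properties hiding (<-trans)
open import Data.Nat.Tactic.RingSolver using (solve-∀)
open import Data.Product.Base using (∃-syntax; _×_; _,_; proj₁; proj₂)
open import Data.Rational.Base as ℚ using (ℚ; 0ℚ; 1ℚ; _<_; _≤_; mkℚ; ↥_; ↧ₙ_; *<*; *≤*)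
import Data.Rational.Properties as ℚ
open import Data.Rational.Properties using (<-trans)
open import Algebra.Definitions.RawSemiring ℚ.+-*-rawSemiring using () renaming (_^_ to _^ℚ_)
open import Data.Sum.Base using (_⊎_; inj₁; inj₂; [_,_]′)
open import Data.Vec.Base using (Vec; []; _∷_; lookup)
open import Data.Vec.Relation.Binary.Pointwise.Inductive using (Pointwise; []; _∷_)
open import Function.Bundles using (_⇔_; module Equivalence)
open import Induction.WellFounded using (Acc; acc)
open import Relation.Binary.PropositionalEquality using (_≡_; refl; sym; trans; cong; cong₂; subst; subst₂)
open import Relation.Nullary using (Dec; yes; no; contradiction)
open import Relation.Unary using (_∈_)

-- Primitive recursive functions

data PR : ℕ → Set where
  zero : ∀ {n} → PR n
  succ : PR 1
  proj : ∀ {n} → Fin n → PR n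
  comp : ∀ {m n} → PR m → Vec (PR n) m → PR n
  prec : ∀ {n} → PR n → PR (2 ℕ.+ n) → PR (1 ℕ.+ n)

⟦_⟧ : ∀ {n} → PR n → Vec ℕ n → ℕ
⟦_⟧* : ∀ {m n} → Vec (PR n) m → Vec ℕ n → Vec ℕ m

⟦ zero ⟧ xs                 = 0
⟦ succ ⟧ (x ∷ [])           = suc x
⟦ proj i ⟧ xs               = lookup xs i
⟦ comp f gs ⟧ xs            = ⟦ f ⟧ (⟦ gs ⟧* xs)
⟦ prec f g ⟧ (zero ∷ xs)    = ⟦ f ⟧ xs
⟦ prec f g ⟧ (suc x ∷ xs)   = ⟦ g ⟧ (x ∷ ⟦ prec f g ⟧ (x ∷ xs) ∷ xs)

⟦ [] ⟧*     xs = []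
⟦ g ∷ gs ⟧* xs = ⟦ g ⟧ xs ∷ ⟦ gs ⟧* xs

compile : ∀ {k n} → PR n → Code k n
compile* : ∀ {k m n} → Vec (PR n) m → Vec (Code k n) m

compile zero        = zero
compile succ        = succ
compile (proj i)    = proj i
compile (comp f gs) = comp (compile f) (compile* gs)
compile (prec f g)  = prec (compile f) (compile g)

compile* []       = []
compile* (g ∷ gs) = compile g ∷ compile* gs

module _ {k} {Ξ : Fin k → ℕ → ℕ} where

  compile-computes : ∀ {n} (f : PR n) xs → Ξ ⊢ compile f [ xs ]⇓ ⟦ f ⟧ xs
  compile*-computes : ∀ {m n} (gs : Vec (PR n) m) xs →
    Pointwise (λ g y → Ξ ⊢ g [ xs ]⇓ y) (compile* gs) (⟦ gs ⟧* xs)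

  compile-computes zero        xs           = zero
  compile-computes succ        (x ∷ [])     = succ
  compile-computes (proj i)    xs           = proj i
  compile-computes (comp f gs) xs           = comp (compile*-computes gs xs) (compile-computes f _)
  compile-computes (prec f g)  (zero ∷ xs)  = prec-zero (compile-computes f xs)
  compile-computes (prec f g)  (suc x ∷ xs) =
    prec-suc (compile-computes (prec f g) (x ∷ xs)) (compile-computes g _)

  compile*-computes []       xs = []
  compile*-computes (g ∷ gs) xs = compile-computes g xs ∷ compile*-computes gs xs

  compile-functional : ∀ {n} (f : PR n) {xs y} → Ξ ⊢ compile f [ xs ]⇓ y → y ≡ ⟦ f ⟧ xs
  compile*-functional : ∀ {m n} (gs : Vec (PR n) m) {xs ys} →
    Pointwise (λ g y → Ξ ⊢ g [ xs ]⇓ y) (compile* gs) ys → ys ≡ ⟦ gs ⟧* xs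

  compile-functional zero        zero           = refl
  compile-functional succ        succ           = refl
  compile-functional (proj i)    (proj i)       = refl
  compile-functional (comp f gs) (comp ds d)    with refl ← compile*-functional gs ds = compile-functional f d
  compile-functional (prec f g)  (prec-zero d)  = compile-functional f d
  compile-functional (prec f g)  (prec-suc d e) with refl ← compile-functional (prec f g) d = compile-functional g e

  compile*-functional []       []       = refl
  compile*-functional (g ∷ gs) (d ∷ ds) = cong₂ _∷_ (compile-functional g d) (compile*-functional gs ds)

pattern v₀ = proj zero
pattern v₁ = proj (suc zero)
pattern v₂ = proj (suc (suc zero))
pattern v₃ = proj (suc (suc (suc zero)))

infixl 8 _·_ _·₂_,_
_·_ : ∀ {n} → PR 1 → PR n → PR n
f · x = comp f (x ∷ [])

_·₂_,_ : ∀ {n} → PR 2 → PR n → PR n → PR n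
f ·₂ x , y = comp f (x ∷ y ∷ [])

constᴾ : ∀ {n} → ℕ → PR n
constᴾ zero    = zero
constᴾ (suc c) = succ · constᴾ c

open ≤-Reasoning

infixl 7 _÷2^_ _mod2^_
_÷2^_ _mod2^_ : ℕ → ℕ → ℕ
x ÷2^ e   = (x / 2 ℕ.^ e) {{m^n≢0 2 e}}
x mod2^ e = (x % 2 ℕ.^ e) {{m^n≢0 2 e}}

⟦const⟧ : ∀ {n} c (xs : Vec ℕ n) → ⟦ constᴾ c ⟧ xs ≡ c
⟦const⟧ zero    xs = refl
⟦const⟧ (suc c) xs = cong suc (⟦const⟧ c xs)

opaque
  addᴾ : PR 2
  addᴾ = prec v₀ (succ · v₁)

  ⟦add⟧ : ∀ x y → ⟦ addᴾ ⟧ (x ∷ y ∷ []) ≡ x ℕ.+ y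
  ⟦add⟧ zero    y = refl
  ⟦add⟧ (suc x) y = cong suc (⟦add⟧ x y)

opaque
  mulᴾ : PR 2
  mulᴾ = prec zero (addᴾ ·₂ v₂ , v₁)

  ⟦mul⟧ : ∀ x y → ⟦ mulᴾ ⟧ (x ∷ y ∷ []) ≡ x ℕ.* y
  ⟦mul⟧ zero    y = refl
  ⟦mul⟧ (suc x) y = trans (⟦add⟧ y _) (cong (y ℕ.+_) (⟦mul⟧ x y))

opaque
  predᴾ : PR 1
  predᴾ = prec zero v₀

  ⟦pred⟧ : ∀ x → ⟦ predᴾ ⟧ (x ∷ []) ≡ ℕ.pred x
  ⟦pred⟧ zero    = refl
  ⟦pred⟧ (suc x) = refl

opaque
  monusᴾ : PR 2
  monusᴾ = prec v₀ (predᴾ · v₁)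

  ⟦monus⟧ : ∀ x y → ⟦ monusᴾ ⟧ (x ∷ y ∷ []) ≡ y ℕ.∸ x
  ⟦monus⟧ zero    y = refl
  ⟦monus⟧ (suc x) y = trans (⟦pred⟧ _) (trans (cong ℕ.pred (⟦monus⟧ x y)) (pred[m∸n]≡m∸[1+n] y x))

opaque
  pow2ᴾ : PR 1
  pow2ᴾ = prec (succ · zero) (addᴾ ·₂ v₁ , v₁)

  ⟦pow2⟧ : ∀ x → ⟦ pow2ᴾ ⟧ (x ∷ []) ≡ 2 ℕ.^ x
  ⟦pow2⟧ zero    = refl
  ⟦pow2⟧ (suc x) = trans (⟦add⟧ _ _)
    (trans (cong₂ ℕ._+_ (⟦pow2⟧ x) (⟦pow2⟧ x)) (cong (2 ℕ.^ x ℕ.+_) (sym (+-identityʳ _))))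

opaque
  notᴾ : PR 1
  notᴾ = prec (succ · zero) zero

  ⟦not⟧ : ∀ x → ⟦ notᴾ ⟧ (x ∷ []) ≡ 1 ℕ.∸ x
  ⟦not⟧ zero    = refl
  ⟦not⟧ (suc x) = sym (0∸n≡0 x)

[2+x]%2 : ∀ x → suc (suc x) % 2 ≡ x % 2
[2+x]%2 x = trans (cong (_% 2) (+-comm 2 x)) ([m+n]%n≡m%n x 2)

[2+x]/2 : ∀ x → suc (suc x) / 2 ≡ suc (x / 2)
[2+x]/2 x = m/n≡1+[m∸n]/n {suc (suc x)} {2} (s≤s (s≤s z≤n))

opaque
  parityᴾ : PR 1
  parityᴾ = prec zero (notᴾ · v₁)

  ⟦parity⟧ : ∀ x → ⟦ parityᴾ ⟧ (x ∷ []) ≡ x % 2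
  ⟦parity⟧ zero    = refl
  ⟦parity⟧ (suc x) = trans (⟦not⟧ _) (trans (cong (1 ℕ.∸_) (⟦parity⟧ x)) (step x))
    where
    step : ∀ x → 1 ℕ.∸ x % 2 ≡ suc x % 2
    step zero          = refl
    step (suc zero)    = refl
    step (suc (suc x)) = trans (cong (1 ℕ.∸_) ([2+x]%2 x)) (trans (step x) (sym ([2+x]%2 (suc x))))

opaque
  halfᴾ : PR 1
  halfᴾ = prec zero (addᴾ ·₂ v₁ , (parityᴾ · v₀))

  ⟦half⟧ : ∀ x → ⟦ halfᴾ ⟧ (x ∷ []) ≡ x / 2
  ⟦half⟧ zero    = refl
  ⟦half⟧ (suc x) = trans (⟦add⟧ _ _) (trans (cong₂ ℕ._+_ (⟦half⟧ x) (⟦parity⟧ x)) (step x))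
    where
    step : ∀ x → x / 2 ℕ.+ x % 2 ≡ suc x / 2
    step zero          = refl
    step (suc zero)    = refl
    step (suc (suc x)) = trans (cong₂ ℕ._+_ ([2+x]/2 x) ([2+x]%2 x))
                               (trans (cong suc (step x)) (sym ([2+x]/2 (suc x))))

÷2^-suc : ∀ e x → x ÷2^ e / 2 ≡ x ÷2^ suc e
÷2^-suc e x = trans (m/n/o≡m/[n*o] x (2 ℕ.^ e) 2) (/-congʳ {m = x} (*-comm (2 ℕ.^ e) 2))
  where instance
    _ = m^n≢0 2 e
    _ = m^n≢0 2 (suc e)
    _ = m*n≢0 (2 ℕ.^ e) 2

opaque
  shiftᴾ : PR 2
  shiftᴾ = prec v₀ (halfᴾ · v₁)

  ⟦shift⟧ : ∀ e x → ⟦ shiftᴾ ⟧ (e ∷ x ∷ []) ≡ x ÷2^ e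
  ⟦shift⟧ zero    x = sym (n/1≡n x)
  ⟦shift⟧ (suc e) x = trans (⟦half⟧ _) (trans (cong (_/ 2) (⟦shift⟧ e x)) (÷2^-suc e x))

opaque
  lowᴾ : PR 2
  lowᴾ = monusᴾ ·₂ (mulᴾ ·₂ (shiftᴾ ·₂ v₀ , v₁) , (pow2ᴾ · v₀)) , v₁

  ⟦low⟧ : ∀ e x → ⟦ lowᴾ ⟧ (e ∷ x ∷ []) ≡ x mod2^ e
  ⟦low⟧ e x = begin-equality
    ⟦ lowᴾ ⟧ (e ∷ x ∷ [])                                              ≡⟨ ⟦monus⟧ _ x ⟩
    x ℕ.∸ ⟦ mulᴾ ⟧ (⟦ shiftᴾ ⟧ (e ∷ x ∷ []) ∷ ⟦ pow2ᴾ ⟧ (e ∷ []) ∷ []) ≡⟨ cong (x ℕ.∸_) (⟦mul⟧ _ _) ⟩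
    x ℕ.∸ ⟦ shiftᴾ ⟧ (e ∷ x ∷ []) ℕ.* ⟦ pow2ᴾ ⟧ (e ∷ [])               ≡⟨ cong₂ (λ a b → x ℕ.∸ a ℕ.* b) (⟦shift⟧ e x) (⟦pow2⟧ e) ⟩
    x ℕ.∸ x ÷2^ e ℕ.* 2 ℕ.^ e                                          ≡⟨ m%n≡m∸m/n*n x (2 ℕ.^ e) {{m^n≢0 2 e}} ⟨
    x mod2^ e                                                          ∎

÷2^-unique : ∀ e y {r} → r ℕ.< 2 ℕ.^ e → (2 ℕ.^ e ℕ.* y ℕ.+ r) ÷2^ e ≡ y
÷2^-unique e y {r} r<2^e = begin-equality
  (2 ℕ.^ e ℕ.* y ℕ.+ r) ÷2^ e           ≡⟨ cong (λ z → (z ℕ.+ r) ÷2^ e) (*-comm (2 ℕ.^ e) y) ⟩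
  (y ℕ.* 2 ℕ.^ e ℕ.+ r) ÷2^ e           ≡⟨ +-distrib-/ (y ℕ.* 2 ℕ.^ e) r (subst (λ z → z ℕ.+ r mod2^ e ℕ.< 2 ℕ.^ e) (sym (m*n%n≡0 y (2 ℕ.^ e))) (m%n<n r (2 ℕ.^ e))) ⟩
  (y ℕ.* 2 ℕ.^ e) ÷2^ e ℕ.+ r ÷2^ e     ≡⟨ cong₂ ℕ._+_ (m*n/n≡m y (2 ℕ.^ e)) (m<n⇒m/n≡0 r<2^e) ⟩
  y ℕ.+ 0                               ≡⟨ +-identityʳ y ⟩
  y                                     ∎
  where instance _ = m^n≢0 2 e

mod2^-unique : ∀ e y {r} → r ℕ.< 2 ℕ.^ e → (2 ℕ.^ e ℕ.* y ℕ.+ r) mod2^ e ≡ r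
mod2^-unique e y {r} r<2^e = begin-equality
  (2 ℕ.^ e ℕ.* y ℕ.+ r) mod2^ e  ≡⟨ cong (_mod2^ e) (trans (+-comm _ r) (cong (r ℕ.+_) (*-comm (2 ℕ.^ e) y))) ⟩
  (r ℕ.+ y ℕ.* 2 ℕ.^ e) mod2^ e  ≡⟨ [m+kn]%n≡m%n r y (2 ℕ.^ e) ⟩
  r mod2^ e                      ≡⟨ m<n⇒m%n≡m r<2^e ⟩
  r                              ∎
  where instance _ = m^n≢0 2 e

-- Strings as numbers

val : List Bool → ℕ
val []      = 0
val (b ∷ w) = bit b ℕ.+ 2 ℕ.* val w

bit<2 : ∀ b → bit b ℕ.< 2
bit<2 false = s≤s z≤n
bit<2 true  = s≤s (s≤s z≤n)

bit-surjective : ∀ {x} → x ℕ.< 2 → ∃[ b ] bit b ≡ x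
bit-surjective {0} _ = false , refl
bit-surjective {1} _ = true , refl
bit-surjective {suc (suc _)} (s≤s (s≤s ()))

encode-∷ : ∀ b σ → suc (encode (b ∷ σ)) ≡ 2 ℕ.* suc (encode σ) ℕ.+ bit b
encode-∷ false σ = rearrange (encode σ)
  where
  rearrange : ∀ s → suc (1 ℕ.+ 2 ℕ.* s) ≡ 2 ℕ.* suc s ℕ.+ 0
  rearrange = solve-∀
encode-∷ true σ = rearrange (encode σ)
  where
  rearrange : ∀ s → suc (2 ℕ.+ 2 ℕ.* s) ≡ 2 ℕ.* suc s ℕ.+ 1
  rearrange = solve-∀

encode-++ : ∀ w σ → suc (encode (w ++ σ)) ≡ 2 ℕ.^ length w ℕ.* suc (encode σ) ℕ.+ val w
encode-++ []      σ = rearrange (encode σ)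
  where
  rearrange : ∀ s → suc s ≡ 1 ℕ.* suc s ℕ.+ 0
  rearrange = solve-∀
encode-++ (b ∷ w) σ = begin-equality
  suc (encode (b ∷ w ++ σ))                                              ≡⟨ encode-∷ b (w ++ σ) ⟩
  2 ℕ.* suc (encode (w ++ σ)) ℕ.+ bit b                                  ≡⟨ cong (λ z → 2 ℕ.* z ℕ.+ bit b) (encode-++ w σ) ⟩
  2 ℕ.* (2 ℕ.^ length w ℕ.* suc (encode σ) ℕ.+ val w) ℕ.+ bit b          ≡⟨ rearrange (2 ℕ.^ length w) (encode σ) (val w) (bit b) ⟩
  2 ℕ.^ length (b ∷ w) ℕ.* suc (encode σ) ℕ.+ val (b ∷ w)                ∎
  where
  rearrange : ∀ p s v b → 2 ℕ.* (p ℕ.* suc s ℕ.+ v) ℕ.+ b ≡ 2 ℕ.* p ℕ.* suc s ℕ.+ (b ℕ.+ 2 ℕ.* v)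
  rearrange = solve-∀

2*+bit< : ∀ {b v p} → b ℕ.< 2 → v ℕ.< p → b ℕ.+ 2 ℕ.* v ℕ.< 2 ℕ.* p
2*+bit< {b} {v} {p} b<2 v<p = ≤-trans (+-monoˡ-≤ (2 ℕ.* v) b<2) (≤-trans (≤-reflexive (sym (*-suc 2 v))) (*-monoʳ-≤ 2 v<p))

val<2^length : ∀ w → val w ℕ.< 2 ℕ.^ length w
val<2^length []      = s≤s z≤n
val<2^length (b ∷ w) = 2*+bit< (bit<2 b) (val<2^length w)

val-surjective : ∀ e {a} → a ℕ.< 2 ℕ.^ e → ∃[ w ] length w ≡ e × val w ≡ a
val-surjective zero    {zero}  _   = [] , refl , refl
val-surjective zero    {suc _} (s≤s ())
val-surjective (suc e) {a}     a<  with val-surjective e {a / 2} (m<n*o⇒m/o<n (subst (a ℕ.<_) (*-comm 2 (2 ℕ.^ e)) a<)) | bit-surjective (m%n<n a 2)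
... | w , refl , val≡ | b , bit≡ = b ∷ w , refl , (begin-equality
  bit b ℕ.+ 2 ℕ.* val w      ≡⟨ cong₂ (λ x y → x ℕ.+ 2 ℕ.* y) bit≡ val≡ ⟩
  a % 2 ℕ.+ 2 ℕ.* (a / 2)    ≡⟨ cong (a % 2 ℕ.+_) (*-comm 2 (a / 2)) ⟩
  a % 2 ℕ.+ a / 2 ℕ.* 2      ≡⟨ m≡m%n+[m/n]*n a 2 ⟨
  a                          ∎)

increment : List Bool → List Bool
increment []          = false ∷ []
increment (false ∷ σ) = true ∷ σ
increment (true ∷ σ)  = false ∷ increment σ

encode-increment : ∀ σ → encode (increment σ) ≡ suc (encode σ)
encode-increment []          = refl
encode-increment (false ∷ σ) = refl
encode-increment (true ∷ σ)  = cong suc (trans (cong (2 ℕ.*_) (encode-increment σ)) (*-suc 2 (encode σ)))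

encode-surjective : ∀ n → ∃[ σ ] encode σ ≡ n
encode-surjective zero    = [] , refl
encode-surjective (suc n) with σ , eq ← encode-surjective n = increment σ , trans (encode-increment σ) (cong suc eq)

encode-∷ʳ : ∀ σ b → encode (σ ∷ʳ b) ≡ encode σ ℕ.+ 2 ℕ.^ length σ ℕ.* suc (bit b)
encode-∷ʳ []          false = refl
encode-∷ʳ []          true  = refl
encode-∷ʳ (false ∷ σ) b     = trans (cong (λ z → 1 ℕ.+ 2 ℕ.* z) (encode-∷ʳ σ b)) (rearrange (encode σ) (2 ℕ.^ length σ) (bit b))
  where
  rearrange : ∀ s p b → 1 ℕ.+ 2 ℕ.* (s ℕ.+ p ℕ.* suc b) ≡ 1 ℕ.+ 2 ℕ.* s ℕ.+ 2 ℕ.* p ℕ.* suc b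
  rearrange = solve-∀
encode-∷ʳ (true ∷ σ)  b     = trans (cong (λ z → 2 ℕ.+ 2 ℕ.* z) (encode-∷ʳ σ b)) (rearrange (encode σ) (2 ℕ.^ length σ) (bit b))
  where
  rearrange : ∀ s p b → 2 ℕ.+ 2 ℕ.* (s ℕ.+ p ℕ.* suc b) ≡ 2 ℕ.+ 2 ℕ.* s ℕ.+ 2 ℕ.* p ℕ.* suc b
  rearrange = solve-∀

encode-bit : ∀ f L q → q ℕ.< L → suc (encode (applyUpTo f L)) ÷2^ q % 2 ≡ bit (f q)
encode-bit f (suc L) zero    _         = begin-equality
  suc (encode (applyUpTo f (suc L))) ÷2^ 0 % 2           ≡⟨ cong (_% 2) (trans (n/1≡n _) (encode-∷ (f 0) _)) ⟩
  (2 ℕ.* suc (encode (applyUpTo _ L)) ℕ.+ bit (f 0)) % 2 ≡⟨ mod2^-unique 1 (suc (encode (applyUpTo (λ j → f (suc j)) L))) (bit<2 (f 0)) ⟩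
  bit (f 0)                                              ∎
encode-bit f (suc L) (suc q) (s≤s q<L) = begin-equality
  suc (encode (f 0 ∷ σ)) ÷2^ suc q % 2                   ≡⟨ cong (λ z → z ÷2^ suc q % 2) (encode-∷ (f 0) σ) ⟩
  (2 ℕ.* suc (encode σ) ℕ.+ bit (f 0)) ÷2^ suc q % 2     ≡⟨ cong (_% 2) (m/n/o≡m/[n*o] _ 2 (2 ℕ.^ q)) ⟨
  (2 ℕ.* suc (encode σ) ℕ.+ bit (f 0)) / 2 ÷2^ q % 2     ≡⟨ cong (λ z → z ÷2^ q % 2) (÷2^-unique 1 (suc (encode σ)) (bit<2 (f 0))) ⟩
  suc (encode σ) ÷2^ q % 2                               ≡⟨ encode-bit (λ j → f (suc j)) L q q<L ⟩
  bit (f (suc q))                                        ∎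
  where
  σ = applyUpTo (λ j → f (suc j)) L
  instance
    _ = m^n≢0 2 q
    _ = m^n≢0 2 (suc q)

-- Applied to positions as well as to encoded strings: on encode σ, k counts the
-- leading zeros of σ and r is the successor of the code of what follows 0^k 1
-- (or 0 if there is no 1).
record Splits (n k r : ℕ) : Set where
  constructor splits
  field suc-≡ : suc n ≡ 2 ℕ.^ k ℕ.* suc (2 ℕ.* r)

2^-even : ∀ d o → (2 ℕ.^ suc d ℕ.* o) % 2 ≡ 0
2^-even d o = trans (cong (_% 2) (trans (*-assoc 2 (2 ℕ.^ d) o) (*-comm 2 (2 ℕ.^ d ℕ.* o)))) (m*n%n≡0 (2 ℕ.^ d ℕ.* o) 2)

2^-÷2^ : ∀ b d o → (2 ℕ.^ (b ℕ.+ d) ℕ.* o) ÷2^ b ≡ 2 ℕ.^ d ℕ.* o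
2^-÷2^ b d o = trans (cong (_÷2^ b) (trans (cong (ℕ._* o) (^-distribˡ-+-* 2 b d))
                 (trans (*-assoc (2 ℕ.^ b) (2 ℕ.^ d) o) (sym (+-identityʳ _)))))
               (÷2^-unique b (2 ℕ.^ d ℕ.* o) (m^n>0 2 b))

opaque
  -- min (b , k) for x = 2^k (2 r + 1)
  searchᴾ : PR 2
  searchᴾ = prec zero (addᴾ ·₂ v₁ , (notᴾ · (parityᴾ · (shiftᴾ ·₂ v₁ , v₂))))

  ⟦search⟧-suc : ∀ b x {s} → ⟦ searchᴾ ⟧ (b ∷ x ∷ []) ≡ s →
    ⟦ searchᴾ ⟧ (suc b ∷ x ∷ []) ≡ s ℕ.+ (1 ℕ.∸ x ÷2^ s % 2)
  ⟦search⟧-suc b x {s} refl = trans (⟦add⟧ _ _) (cong (s ℕ.+_)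
    (trans (⟦not⟧ _) (cong (1 ℕ.∸_) (trans (⟦parity⟧ _) (cong (_% 2) (⟦shift⟧ s x))))))

  ⟦search⟧-below : ∀ b d o → ⟦ searchᴾ ⟧ (b ∷ 2 ℕ.^ (b ℕ.+ d) ℕ.* o ∷ []) ≡ b
  ⟦search⟧-below zero    d o = refl
  ⟦search⟧-below (suc b) d o = begin-equality
    ⟦ searchᴾ ⟧ (suc b ∷ 2 ℕ.^ (suc b ℕ.+ d) ℕ.* o ∷ [])   ≡⟨ cong (λ z → ⟦ searchᴾ ⟧ (suc b ∷ 2 ℕ.^ z ℕ.* o ∷ [])) (+-suc b d) ⟨
    ⟦ searchᴾ ⟧ (suc b ∷ x ∷ [])                           ≡⟨ ⟦search⟧-suc b x (⟦search⟧-below b (suc d) o) ⟩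
    b ℕ.+ (1 ℕ.∸ x ÷2^ b % 2)                              ≡⟨ cong (λ z → b ℕ.+ (1 ℕ.∸ z)) (trans (cong (_% 2) (2^-÷2^ b (suc d) o)) (2^-even d o)) ⟩
    b ℕ.+ 1                                                ≡⟨ +-comm b 1 ⟩
    suc b                                                  ∎
    where
    x : ℕ
    x = 2 ℕ.^ (b ℕ.+ suc d) ℕ.* o

  ⟦search⟧-above : ∀ d k r → ⟦ searchᴾ ⟧ (d ℕ.+ k ∷ 2 ℕ.^ k ℕ.* suc (2 ℕ.* r) ∷ []) ≡ k
  ⟦search⟧-above zero    k r = subst (λ z → ⟦ searchᴾ ⟧ (k ∷ 2 ℕ.^ z ℕ.* suc (2 ℕ.* r) ∷ []) ≡ k) (+-identityʳ k) (⟦search⟧-below k 0 (suc (2 ℕ.* r)))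
  ⟦search⟧-above (suc d) k r = begin-equality
    ⟦ searchᴾ ⟧ (suc d ℕ.+ k ∷ x ∷ [])   ≡⟨ ⟦search⟧-suc (d ℕ.+ k) x (⟦search⟧-above d k r) ⟩
    k ℕ.+ (1 ℕ.∸ x ÷2^ k % 2)            ≡⟨ cong (λ z → k ℕ.+ (1 ℕ.∸ z)) odd ⟩
    k ℕ.+ 0                              ≡⟨ +-identityʳ k ⟩
    k                                    ∎
    where
    x : ℕ
    x = 2 ℕ.^ k ℕ.* suc (2 ℕ.* r)
    odd : x ÷2^ k % 2 ≡ 1
    odd = trans (cong (_% 2) (trans (cong (_÷2^ k) (sym (+-identityʳ x))) (÷2^-unique k (suc (2 ℕ.* r)) (m^n>0 2 k))))
                (trans (cong (_% 2) (+-comm 1 (2 ℕ.* r))) (mod2^-unique 1 r (s≤s (s≤s z≤n))))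

n<2^n : ∀ n → n ℕ.< 2 ℕ.^ n
n<2^n zero    = s≤s z≤n
n<2^n (suc n) = ≤-trans (≤-reflexive (sym (+-comm (suc n) 1))) (+-mono-≤ (n<2^n n) (≤-trans (m^n>0 2 n) (m≤m+n _ 0)))

opaque
  levelᴾ : PR 1
  levelᴾ = searchᴾ ·₂ (succ · v₀) , (succ · v₀)

  ⟦level⟧ : ∀ {n k r} → Splits n k r → ⟦ levelᴾ ⟧ (n ∷ []) ≡ k
  ⟦level⟧ {n} {k} {r} (splits eq) = begin-equality
    ⟦ searchᴾ ⟧ (suc n ∷ suc n ∷ [])                  ≡⟨ cong₂ (λ y z → ⟦ searchᴾ ⟧ (y ∷ z ∷ [])) (trans eq (sym (m∸n+n≡m k≤x))) eq ⟩
    ⟦ searchᴾ ⟧ (x ℕ.∸ k ℕ.+ k ∷ x ∷ [])              ≡⟨ ⟦search⟧-above (x ℕ.∸ k) k r ⟩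
    k                                                 ∎
    where
    x : ℕ
    x = 2 ℕ.^ k ℕ.* suc (2 ℕ.* r)
    k≤x : k ℕ.≤ x
    k≤x = ≤-trans (<⇒≤ (n<2^n k)) (m≤m*n (2 ℕ.^ k) (suc (2 ℕ.* r)))

opaque
  restᴾ : PR 1
  restᴾ = shiftᴾ ·₂ (succ · levelᴾ) , (succ · v₀)

  ⟦rest⟧ : ∀ {n k r} → Splits n k r → ⟦ restᴾ ⟧ (n ∷ []) ≡ r
  ⟦rest⟧ {n} {k} {r} s@(splits eq) = begin-equality
    ⟦ shiftᴾ ⟧ (suc (⟦ levelᴾ ⟧ (n ∷ [])) ∷ suc n ∷ [])  ≡⟨ ⟦shift⟧ _ _ ⟩
    suc n ÷2^ suc (⟦ levelᴾ ⟧ (n ∷ []))                  ≡⟨ cong₂ (λ k x → x ÷2^ suc k) (⟦level⟧ s) (trans eq (rearrange (2 ℕ.^ k) r)) ⟩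
    (2 ℕ.^ suc k ℕ.* r ℕ.+ 2 ℕ.^ k) ÷2^ suc k            ≡⟨ ÷2^-unique (suc k) r (^-monoʳ-< 2 (s≤s (s≤s z≤n)) (n<1+n k)) ⟩
    r                                                    ∎
    where
    rearrange : ∀ p r → p ℕ.* suc (2 ℕ.* r) ≡ 2 ℕ.* p ℕ.* r ℕ.+ p
    rearrange = solve-∀

module Coding (C : ℕ) where

  window : ℕ → ℕ
  window k = suc (suc C ℕ.* k)

  opaque
    windowᴾ : PR 1
    windowᴾ = succ · (mulᴾ ·₂ constᴾ (suc C) , levelᴾ)

    ⟦window⟧ : ∀ {n k r} → Splits n k r → ⟦ windowᴾ ⟧ (n ∷ []) ≡ window k
    ⟦window⟧ {n} s = cong suc (trans (⟦mul⟧ _ _) (cong₂ ℕ._*_ (⟦const⟧ (suc C) (n ∷ [])) (⟦level⟧ s)))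

  opaque
    positionᴾ : PR 1
    positionᴾ = lowᴾ ·₂ (mulᴾ ·₂ constᴾ C , levelᴾ) , restᴾ

    ⟦position⟧ : ∀ {n k r} → Splits n k r → ⟦ positionᴾ ⟧ (n ∷ []) ≡ r mod2^ (C ℕ.* k)
    ⟦position⟧ {n} s = trans (⟦low⟧ _ _) (cong₂ (λ e r → r mod2^ e)
      (trans (⟦mul⟧ _ _) (cong₂ ℕ._*_ (⟦const⟧ C (n ∷ [])) (⟦level⟧ s))) (⟦rest⟧ s))

  opaque
    payloadᴾ : PR 1
    payloadᴾ = shiftᴾ ·₂ windowᴾ , restᴾ

    ⟦payload⟧ : ∀ {n k r} → Splits n k r → ⟦ payloadᴾ ⟧ (n ∷ []) ≡ r ÷2^ window k
    ⟦payload⟧ s = trans (⟦shift⟧ _ _) (cong₂ (λ e r → r ÷2^ e) (⟦window⟧ s) (⟦rest⟧ s))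

  offset : ℕ → ℕ → ℕ → ℕ
  offset k r j = (2 ℕ.^ k ℕ.* suc (2 ℕ.* j) ℕ.+ r) mod2^ window k

  opaque
    offsetᴾ : PR 2
    offsetᴾ = lowᴾ ·₂ (windowᴾ · v₁) , (addᴾ ·₂ (mulᴾ ·₂ (pow2ᴾ · (levelᴾ · v₁)) , (succ · (mulᴾ ·₂ constᴾ 2 , v₀))) , (restᴾ · v₁))

    ⟦offset⟧ : ∀ {n k r} j → Splits n k r → ⟦ offsetᴾ ⟧ (j ∷ n ∷ []) ≡ offset k r j
    ⟦offset⟧ {n} {k} {r} j s = trans (⟦low⟧ _ _) (cong₂ (λ e x → x mod2^ e) (⟦window⟧ s)
      (trans (⟦add⟧ _ _) (cong₂ ℕ._+_
        (trans (⟦mul⟧ _ _) (cong₂ ℕ._*_ (trans (⟦pow2⟧ _) (cong (2 ℕ.^_) (⟦level⟧ s)))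
                                        (cong suc (⟦mul⟧ 2 j))))
        (⟦rest⟧ s))))

  opaque
    outputᴾ : PR 3
    outputᴾ = prec zero (addᴾ ·₂ v₁ , (mulᴾ ·₂ (pow2ᴾ · v₀) , (succ · (parityᴾ · (shiftᴾ ·₂ (offsetᴾ ·₂ v₀ , v₂) , (succ · v₃))))))

    ⟦output⟧ : ∀ {n k r t} (Z : ℕ → Bool) m → Splits n k r →
      (∀ j → j ℕ.< m → suc t ÷2^ offset k r j % 2 ≡ bit (Z j)) →
      ⟦ outputᴾ ⟧ (m ∷ n ∷ t ∷ []) ≡ encode (Z ↾ m)
    ⟦output⟧ Z zero s bits = refl
    ⟦output⟧ {n} {k} {r} {t} Z (suc m) s bits = begin-equality
      ⟦ outputᴾ ⟧ (suc m ∷ n ∷ t ∷ [])                       ≡⟨ trans (⟦add⟧ _ _) (cong (ih ℕ.+_) (⟦mul⟧ _ _)) ⟩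
      ih ℕ.+ ⟦ pow2ᴾ ⟧ (m ∷ []) ℕ.* suc (⟦ parityᴾ ⟧ (⟦ shiftᴾ ⟧ (⟦ offsetᴾ ⟧ (m ∷ n ∷ []) ∷ suc t ∷ []) ∷ []))
        ≡⟨ cong₂ ℕ._+_ (⟦output⟧ Z m s (λ j j<m → bits j (m<n⇒m<1+n j<m))) (cong₂ (λ x y → x ℕ.* suc y) (⟦pow2⟧ m) digit) ⟩
      encode (Z ↾ m) ℕ.+ 2 ℕ.^ m ℕ.* suc (bit (Z m))         ≡⟨ cong (λ l → encode (Z ↾ m) ℕ.+ 2 ℕ.^ l ℕ.* suc (bit (Z m))) (length-applyUpTo Z m) ⟨
      encode (Z ↾ m) ℕ.+ 2 ℕ.^ length (Z ↾ m) ℕ.* suc (bit (Z m))  ≡⟨ encode-∷ʳ (Z ↾ m) (Z m) ⟨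
      encode (Z ↾ m ∷ʳ Z m)                                  ≡⟨ cong encode (applyUpTo-∷ʳ Z m) ⟩
      encode (Z ↾ suc m)                                     ∎
      where
      ih : ℕ
      ih = ⟦ outputᴾ ⟧ (m ∷ n ∷ t ∷ [])
      digit : ⟦ parityᴾ ⟧ (⟦ shiftᴾ ⟧ (⟦ offsetᴾ ⟧ (m ∷ n ∷ []) ∷ suc t ∷ []) ∷ []) ≡ bit (Z m)
      digit = trans (⟦parity⟧ _) (trans (cong (_% 2) (⟦shift⟧ _ _))
                (trans (cong (λ q → suc t ÷2^ q % 2) (⟦offset⟧ m s)) (bits m (n<1+n m))))

  opaque
    decoderᴾ : PR 3
    decoderᴾ = comp outputᴾ ((pow2ᴾ · (mulᴾ ·₂ constᴾ C , (levelᴾ · v₀))) ∷ v₀ ∷ v₁ ∷ [])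

    ⟦decoder⟧ : ∀ {n k r t i} (Z : ℕ → Bool) → Splits n k r →
      (∀ j → j ℕ.< 2 ℕ.^ (C ℕ.* k) → suc t ÷2^ offset k r j % 2 ≡ bit (Z j)) →
      ⟦ decoderᴾ ⟧ (n ∷ t ∷ i ∷ []) ≡ encode (Z ↾ 2 ℕ.^ (C ℕ.* k))
    ⟦decoder⟧ {n} {k} {r} {t} {i} Z s bits =
      trans (cong (λ m → ⟦ outputᴾ ⟧ (m ∷ n ∷ t ∷ []))
              (trans (⟦pow2⟧ _) (cong (2 ℕ.^_) (trans (⟦mul⟧ _ _) (cong₂ ℕ._*_ (⟦const⟧ C (n ∷ t ∷ i ∷ [])) (⟦level⟧ s))))))
            (⟦output⟧ Z (2 ℕ.^ (C ℕ.* k)) s bits)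

  -- The window of length 2^(window k) after i contains, for each j < 2^(C k),
  -- a position of level k carrying the j-th bit.
  position-offset : ∀ i k r {s j} → j ℕ.< 2 ℕ.^ (C ℕ.* k) → r ℕ.+ suc i ≡ s ℕ.* 2 ℕ.^ window k →
    ⟦ positionᴾ ⟧ (i ℕ.+ offset k r j ∷ []) ≡ j
  position-offset i k r {s} {j} j<m eq = begin-equality
    ⟦ positionᴾ ⟧ (i ℕ.+ q ∷ [])                ≡⟨ ⟦position⟧ (splits total) ⟩
    (j ℕ.+ m ℕ.* t) mod2^ (C ℕ.* k)             ≡⟨ cong (_mod2^ (C ℕ.* k)) (+-comm j _) ⟩
    (m ℕ.* t ℕ.+ j) mod2^ (C ℕ.* k)             ≡⟨ mod2^-unique (C ℕ.* k) t j<m ⟩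
    j                                           ∎
    where
    instance
      _ : NonZero (2 ℕ.^ window k)
      _ = m^n≢0 2 (window k)
    P m q x t : ℕ
    P = 2 ℕ.^ window k
    m = 2 ℕ.^ (C ℕ.* k)
    q = offset k r j
    x = 2 ℕ.^ k ℕ.* suc (2 ℕ.* j)
    t = (q ℕ.+ suc i) / P
    P≡ : P ≡ 2 ℕ.^ k ℕ.* (2 ℕ.* m)
    P≡ = trans (cong (2 ℕ.*_) (^-distribˡ-+-* 2 k (C ℕ.* k))) (rearrange (2 ℕ.^ k) m)
      where
      rearrange : ∀ a b → 2 ℕ.* (a ℕ.* b) ≡ a ℕ.* (2 ℕ.* b)
      rearrange = solve-∀
    x<P : x ℕ.< P
    x<P = subst (x ℕ.<_) (sym P≡) (*-monoʳ-< (2 ℕ.^ k) {{m^n≢0 2 k}}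
            (≤-trans (≤-reflexive (sym (*-suc 2 j))) (*-monoʳ-≤ 2 j<m)))
    residue : (q ℕ.+ suc i) % P ≡ x
    residue = begin-equality
      (q ℕ.+ suc i) % P                             ≡⟨ %-distribˡ-+ q (suc i) P ⟩
      (q % P ℕ.+ suc i % P) % P                     ≡⟨ cong (λ z → (z ℕ.+ suc i % P) % P) (m%n%n≡m%n (x ℕ.+ r) P) ⟩
      ((x ℕ.+ r) % P ℕ.+ suc i % P) % P             ≡⟨ %-distribˡ-+ (x ℕ.+ r) (suc i) P ⟨
      (x ℕ.+ r ℕ.+ suc i) % P                       ≡⟨ cong (_% P) (trans (+-assoc x r (suc i)) (cong (x ℕ.+_) eq)) ⟩
      (x ℕ.+ s ℕ.* P) % P                           ≡⟨ [m+kn]%n≡m%n x s P ⟩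
      x % P                                         ≡⟨ m<n⇒m%n≡m x<P ⟩
      x                                             ∎
    total : suc (i ℕ.+ q) ≡ 2 ℕ.^ k ℕ.* suc (2 ℕ.* (j ℕ.+ m ℕ.* t))
    total = begin-equality
      suc (i ℕ.+ q)                                 ≡⟨ +-comm (suc i) q ⟩
      q ℕ.+ suc i                                   ≡⟨ m≡m%n+[m/n]*n (q ℕ.+ suc i) P ⟩
      (q ℕ.+ suc i) % P ℕ.+ t ℕ.* P                 ≡⟨ cong₂ (λ a b → a ℕ.+ t ℕ.* b) residue P≡ ⟩
      x ℕ.+ t ℕ.* (2 ℕ.^ k ℕ.* (2 ℕ.* m))           ≡⟨ rearrange (2 ℕ.^ k) j m t ⟩
      2 ℕ.^ k ℕ.* suc (2 ℕ.* (j ℕ.+ m ℕ.* t))       ∎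
      where
      rearrange : ∀ a j m t → a ℕ.* suc (2 ℕ.* j) ℕ.+ t ℕ.* (a ℕ.* (2 ℕ.* m)) ≡ a ℕ.* suc (2 ℕ.* (j ℕ.+ m ℕ.* t))
      rearrange = solve-∀

  residue-complement : ∀ i e → ∃[ a ] a ℕ.< 2 ℕ.^ e × ∃[ s ] a ℕ.+ suc i ≡ s ℕ.* 2 ℕ.^ e
  residue-complement i e = a , ∸-monoʳ-< (s≤s z≤n) 1+i%P≤P , suc (i / P) , (begin-equality
    a ℕ.+ suc i                               ≡⟨ cong (λ z → a ℕ.+ suc z) (m≡m%n+[m/n]*n i P) ⟩
    a ℕ.+ (suc (i % P) ℕ.+ i / P ℕ.* P)       ≡⟨ +-assoc a _ _ ⟨
    a ℕ.+ suc (i % P) ℕ.+ i / P ℕ.* P         ≡⟨ cong (ℕ._+ i / P ℕ.* P) (m∸n+n≡m 1+i%P≤P) ⟩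
    suc (i / P) ℕ.* P                         ∎)
    where
    instance
      _ : NonZero (2 ℕ.^ e)
      _ = m^n≢0 2 e
    P a : ℕ
    P = 2 ℕ.^ e
    a = P ℕ.∸ suc (i % P)
    1+i%P≤P : suc (i % P) ℕ.≤ P
    1+i%P≤P = m%n<n i P

  header : ℕ → List Bool → List Bool → List Bool
  header k w p = replicate k false ++ true ∷ w ++ p

  splits-zeros : ∀ k → Splits (encode (replicate k false)) k 0
  splits-zeros zero    = splits refl
  splits-zeros (suc k) with splits eq ← splits-zeros k = splits (begin-equality
    suc (encode (replicate (suc k) false))             ≡⟨ encode-∷ false (replicate k false) ⟩
    2 ℕ.* suc (encode (replicate k false)) ℕ.+ 0       ≡⟨ cong (λ z → 2 ℕ.* z ℕ.+ 0) eq ⟩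
    2 ℕ.* (2 ℕ.^ k ℕ.* 1) ℕ.+ 0                        ≡⟨ trans (+-identityʳ _) (sym (*-assoc 2 (2 ℕ.^ k) 1)) ⟩
    2 ℕ.^ suc k ℕ.* 1                                  ∎)

  splits-zeros-one : ∀ k σ → Splits (encode (replicate k false ++ true ∷ σ)) k (suc (encode σ))
  splits-zeros-one zero    σ = splits (trans (encode-∷ true σ) (rearrange (encode σ)))
    where
    rearrange : ∀ s → 2 ℕ.* suc s ℕ.+ 1 ≡ 1 ℕ.* suc (2 ℕ.* suc s)
    rearrange = solve-∀
  splits-zeros-one (suc k) σ with splits eq ← splits-zeros-one k σ = splits (begin-equality
    suc (encode (false ∷ τ))                           ≡⟨ encode-∷ false τ ⟩
    2 ℕ.* suc (encode τ) ℕ.+ 0                         ≡⟨ cong (λ z → 2 ℕ.* z ℕ.+ 0) eq ⟩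
    2 ℕ.* (2 ℕ.^ k ℕ.* suc (2 ℕ.* suc (encode σ))) ℕ.+ 0
      ≡⟨ trans (+-identityʳ _) (sym (*-assoc 2 (2 ℕ.^ k) _)) ⟩
    2 ℕ.^ suc k ℕ.* suc (2 ℕ.* suc (encode σ))         ∎)
    where
    τ : List Bool
    τ = replicate k false ++ true ∷ σ

  zeros-view : ∀ σ → ∃[ k ] (σ ≡ replicate k false ⊎ ∃[ τ ] σ ≡ replicate k false ++ true ∷ τ)
  zeros-view []          = 0 , inj₁ refl
  zeros-view (true ∷ σ)  = 0 , inj₂ (σ , refl)
  zeros-view (false ∷ σ) with zeros-view σ
  ... | k , inj₁ refl       = suc k , inj₁ refl
  ... | k , inj₂ (τ , refl) = suc k , inj₂ (τ , refl)

  payload-header : ∀ k w p → length w ≡ window k → ⟦ payloadᴾ ⟧ (encode (header k w p) ∷ []) ≡ suc (encode p)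
  payload-header k w p eq = begin-equality
    ⟦ payloadᴾ ⟧ (encode (header k w p) ∷ [])                                ≡⟨ ⟦payload⟧ (splits-zeros-one k (w ++ p)) ⟩
    suc (encode (w ++ p)) ÷2^ window k                                       ≡⟨ cong (λ e → suc (encode (w ++ p)) ÷2^ e) eq ⟨
    suc (encode (w ++ p)) ÷2^ length w                                       ≡⟨ cong (_÷2^ length w) (encode-++ w p) ⟩
    (2 ℕ.^ length w ℕ.* suc (encode p) ℕ.+ val w) ÷2^ length w               ≡⟨ ÷2^-unique (length w) (suc (encode p)) (val<2^length w) ⟩
    suc (encode p)                                                           ∎

  encode<2^ : ∀ σ {e} → length σ ℕ.< e → suc (encode σ) ℕ.< 2 ℕ.^ e
  encode<2^ []      l<e = ≤-<-trans l<e (n<2^n _)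
  encode<2^ (b ∷ σ) {suc e} (s≤s l<e) = subst (ℕ._< 2 ℕ.^ suc e)
    (trans (+-comm (bit b) _) (sym (encode-∷ b σ))) (2*+bit< (bit<2 b) (encode<2^ σ l<e))

  payload-positive : ∀ σ {h} → ⟦ payloadᴾ ⟧ (encode σ ∷ []) ≡ suc h →
    ∃[ k ] ∃[ w ] ∃[ p ] length w ≡ window k × σ ≡ header k w p
  payload-positive σ eq with zeros-view σ
  ... | k , inj₁ refl =
    contradiction (trans (sym eq) (trans (⟦payload⟧ (splits-zeros k)) (0/n≡0 (2 ℕ.^ window k) {{m^n≢0 2 (window k)}}))) λ ()
  ... | k , inj₂ (τ , refl) with length τ <? window k
  ...   | yes short =
    contradiction (trans (sym eq) (trans (⟦payload⟧ (splits-zeros-one k τ)) (m<n⇒m/n≡0 {{m^n≢0 2 (window k)}} (encode<2^ τ short)))) λ ()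
  ...   | no ¬short = k , take (window k) τ , drop (window k) τ
    , trans (length-take (window k) τ) (m≤n⇒m⊓n≡m (≮⇒≥ ¬short))
    , cong (λ z → replicate k false ++ true ∷ z) (sym (take++drop≡id (window k) τ))

  -- The guard makes the machine diverge on strings that are too short.
  machine : Machine → Machine
  machine U = comp (compile decoderᴾ)
    (proj zero ∷ comp U (compile (predᴾ · payloadᴾ) ∷ []) ∷ mu (compile (notᴾ · (payloadᴾ · v₁))) ∷ [])

  module _ {U : Machine} where

    halting-in-domain : ∀ {p y} → no-oracles ⊢ U [ encode p ∷ [] ]⇓ y → p ∈ dom U
    halting-in-domain {y = y} u with τ , refl ← encode-surjective y = τ , u

    machine-domain : ∀ {k w p} → length w ≡ window k → header k w p ∈ dom (machine U) → p ∈ dom U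
    machine-domain {k} {w} {p} eq (_ , comp (_ ∷ comp (d ∷ []) u ∷ _) _) =
      halting-in-domain {p} (subst (λ n → no-oracles ⊢ U [ n ∷ [] ]⇓ _)
        (trans (compile-functional (predᴾ · payloadᴾ) d) (trans (⟦pred⟧ _) (cong ℕ.pred (payload-header k w p eq)))) u)

    domain-header : ∀ {σ} → σ ∈ dom (machine U) → ∃[ k ] ∃[ w ] ∃[ p ] length w ≡ window k × σ ≡ header k w p
    domain-header {σ} (_ , comp (_ ∷ _ ∷ mu _ d ∷ []) _) =
      payload-positive σ (positive (trans (compile-functional (notᴾ · (payloadᴾ · v₁)) d) (⟦not⟧ _)))
      where
      positive : ∀ {h} → 0 ≡ 1 ℕ.∸ h → h ≡ suc (ℕ.pred h)
      positive {suc h} _ = refl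

    machine-prefixFree : PrefixFree U → PrefixFree (machine U)
    machine-prefixFree pf σ τ σ∈dom στ∈dom with k , w , p , eq , refl ← domain-header {σ} σ∈dom =
      pf p τ (machine-domain {k} {w} eq σ∈dom)
        (machine-domain {k} {w} eq (subst (_∈ dom (machine U)) assoc στ∈dom))
      where
      assoc : header k w p ++ τ ≡ header k w (p ++ τ)
      assoc = trans (++-assoc (replicate k false) _ τ) (cong (λ z → replicate k false ++ true ∷ z) (++-assoc w p τ))

    machine-computes : ∀ Z i k {L} → 2 ℕ.^ window k ℕ.≤ L →
      ∃[ w ] length w ≡ window k × (∀ p →
        U ⟨ p ⟩≃ (λ j → Z (⟦ positionᴾ ⟧ (i ℕ.+ j ∷ []))) ↾ L →
        machine U ⟨ header k w p ⟩≃ Z ↾ 2 ℕ.^ (C ℕ.* k))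
    machine-computes Z i k {L} P≤L
      with a , a<P , s , a+1+i≡ ← residue-complement i (window k)
      with w , length≡ , val≡ ← val-surjective (window k) a<P = w , length≡ , computes
      where
      computes : ∀ p → _ → _
      computes p u = subst (λ z → no-oracles ⊢ machine U [ encode (header k w p) ∷ [] ]⇓ z)
        (⟦decoder⟧ Z split bits)
        (comp (proj zero
              ∷ comp (compile-computes (predᴾ · payloadᴾ) _ ∷ []) (subst (λ n → no-oracles ⊢ U [ n ∷ [] ]⇓ encode τ) (sym pred≡) u)
              ∷ mu (λ _ ()) (subst (λ z → no-oracles ⊢ compile (notᴾ · (payloadᴾ · v₁)) [ 0 ∷ encode (header k w p) ∷ [] ]⇓ z) guard≡ (compile-computes (notᴾ · (payloadᴾ · v₁)) _))
              ∷ [])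
              (compile-computes decoderᴾ _))
        where
        τ : List Bool
        τ = (λ j → Z (⟦ positionᴾ ⟧ (i ℕ.+ j ∷ []))) ↾ L
        r : ℕ
        r = suc (encode (w ++ p))
        split : Splits (encode (header k w p)) k r
        split = splits-zeros-one k (w ++ p)
        pred≡ : ⟦ predᴾ · payloadᴾ ⟧ (encode (header k w p) ∷ []) ≡ encode p
        pred≡ = trans (⟦pred⟧ _) (cong ℕ.pred (payload-header k w p length≡))
        guard≡ : ⟦ notᴾ · (payloadᴾ · v₁) ⟧ (0 ∷ encode (header k w p) ∷ []) ≡ 0
        guard≡ = trans (⟦not⟧ _) (trans (cong (1 ℕ.∸_) (payload-header k w p length≡)) (0∸n≡0 (encode p)))
        r+1+i≡ : r ℕ.+ suc i ≡ (suc (encode p) ℕ.+ s) ℕ.* 2 ℕ.^ window k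
        r+1+i≡ = begin-equality
          r ℕ.+ suc i                                                 ≡⟨ cong (ℕ._+ suc i) (encode-++ w p) ⟩
          2 ℕ.^ length w ℕ.* suc (encode p) ℕ.+ val w ℕ.+ suc i       ≡⟨ cong₂ (λ e v → 2 ℕ.^ e ℕ.* suc (encode p) ℕ.+ v ℕ.+ suc i) length≡ val≡ ⟩
          2 ℕ.^ window k ℕ.* suc (encode p) ℕ.+ a ℕ.+ suc i           ≡⟨ +-assoc _ a (suc i) ⟩
          2 ℕ.^ window k ℕ.* suc (encode p) ℕ.+ (a ℕ.+ suc i)         ≡⟨ cong₂ ℕ._+_ (*-comm (2 ℕ.^ window k) _) a+1+i≡ ⟩
          suc (encode p) ℕ.* 2 ℕ.^ window k ℕ.+ s ℕ.* 2 ℕ.^ window k  ≡⟨ *-distribʳ-+ (2 ℕ.^ window k) (suc (encode p)) s ⟨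
          (suc (encode p) ℕ.+ s) ℕ.* 2 ℕ.^ window k                   ∎
        bits : ∀ j → j ℕ.< 2 ℕ.^ (C ℕ.* k) → suc (encode τ) ÷2^ offset k r j % 2 ≡ bit (Z j)
        bits j j<m = trans
          (encode-bit _ L (offset k r j) (<-≤-trans (m%n<n (2 ℕ.^ k ℕ.* suc (2 ℕ.* j) ℕ.+ r) (2 ℕ.^ window k) {{m^n≢0 2 (window k)}}) P≤L))
          (cong (λ z → bit (Z z)) (position-offset i k r {suc (encode p) ℕ.+ s} j<m r+1+i≡))

-- Roots of natural numbers

ι : ℕ → ℚ
ι n = + n ℚ./ 1

ι-mkℚ : ∀ n → ι n ≡ mkℚ (+ n) 0 (coprime-sym (1-coprimeTo n))
ι-mkℚ n = ℚ.↥p/↧p≡p (mkℚ (+ n) 0 (coprime-sym (1-coprimeTo n)))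

ι-+ : ∀ m n → ι (m ℕ.+ n) ≡ ι m ℚ.+ ι n
ι-+ m n = sym (trans (cong₂ ℚ._+_ (ι-mkℚ m) (ι-mkℚ n))
  (cong (ℚ._/ 1) (cong₂ ℤ._+_ (ℤ.*-identityʳ (+ m)) (ℤ.*-identityʳ (+ n)))))

ι-* : ∀ m n → ι (m ℕ.* n) ≡ ι m ℚ.* ι n
ι-* m n = sym (trans (cong₂ ℚ._*_ (ι-mkℚ m) (ι-mkℚ n)) (cong (ℚ._/ 1) (sym (ℤ.pos-* m n))))

ι-^ : ∀ m q → ι (m ℕ.^ q) ≡ ι m ^ℚ q
ι-^ m zero    = refl
ι-^ m (suc q) = trans (ι-* m (m ℕ.^ q)) (cong (ι m ℚ.*_) (ι-^ m q))

ι-mono-≤ : ∀ {m n} → m ℕ.≤ n → ι m ≤ ι n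
ι-mono-≤ {m} {n} m≤n = subst₂ _≤_ (sym (ι-mkℚ m)) (sym (ι-mkℚ n)) (*≤* (ℤ.*-monoʳ-≤-nonNeg (+ 1) (ℤ.+≤+ m≤n)))

ι-mono-< : ∀ {m n} → m ℕ.< n → ι m < ι n
ι-mono-< {m} {n} m<n = ℚ.<-≤-trans m<1+m (ι-mono-≤ m<n)
  where
  m<1+m : ι m < ι (suc m)
  m<1+m = subst (ι m <_) (trans (sym (ι-+ m 1)) (cong ι (+-comm m 1)))
            (subst (_< ι m ℚ.+ 1ℚ) (ℚ.+-identityʳ (ι m)) (ℚ.+-monoʳ-< (ι m) (ℚ.positive⁻¹ 1ℚ)))

root≤ : ∀ q .{{_ : NonZero q}} N c k → N ℕ.≤ (k ℕ.+ c) ℕ.^ q → root q N -ℝ ι c ≤ℝ fromℕ k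
root≤ q@(suc q-1) N c k N≤ r (s , r+c<s , s∈) with r ℚ.<? ι k
... | yes r<k = r<k
... | no  r≮k = contradiction s∈ λ where
        (inj₁ s<0)   → ℚ.<-irrefl refl (ℚ.<-trans k+c<s (ℚ.<-≤-trans s<0 (0≤+n/1 (k ℕ.+ c))))
        (inj₂ s^q≤N) → ℚ.<-irrefl refl (ℚ.<-≤-trans (^-mono-< (0≤+n/1 (k ℕ.+ c)) k+c<s q-1)
                         (ℚ.≤-trans s^q≤N (ℚ.≤-trans (ι-mono-≤ N≤) (ℚ.≤-reflexive (ι-^ (k ℕ.+ c) q)))))
  where
  k+c<s : ι (k ℕ.+ c) < s
  k+c<s = ℚ.≤-<-trans (ℚ.≤-trans (ℚ.≤-reflexive (ι-+ k c)) (ℚ.+-monoˡ-≤ (ι c) (ℚ.≮⇒≥ r≮k))) r+c<s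

root≤⁻¹ : ∀ q .{{_ : NonZero q}} N c k → root q N -ℝ ι c ≤ℝ fromℕ k → N ℕ.≤ suc (k ℕ.+ c) ℕ.^ q
root≤⁻¹ q@(suc _) N c k root≤k with N ≤? suc (k ℕ.+ c) ℕ.^ q
... | yes N≤ = N≤
... | no  N≰ = contradiction (root≤k (ι k) (ι (suc (k ℕ.+ c))
        , ℚ.≤-<-trans (ℚ.≤-reflexive (sym (ι-+ k c))) (ι-mono-< (n<1+n (k ℕ.+ c)))
        , inj₂ (ℚ.≤-trans (ℚ.≤-reflexive (sym (ι-^ (suc (k ℕ.+ c)) q))) (ι-mono-≤ (<⇒≤ (≰⇒> N≰))))))
        (ℚ.<-irrefl refl)

-- The existence of K(σ) is only classical, but a counterexample of least length
-- would be K(σ).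
K-bounds-descriptions : ∀ U σ {P : ℕ → Set} → (∀ k → Dec (P k)) → (∀ {k l} → k ℕ.≤ l → P k → P l) →
  (∀ k → K U σ k → P k) → ∀ p → U ⟨ p ⟩≃ σ → P (length p)
K-bounds-descriptions U σ {P} P? upper P-K p = go p (<-wellFounded (length p))
  where
  go : ∀ p → Acc ℕ._<_ (length p) → U ⟨ p ⟩≃ σ → P (length p)
  go p (acc rec) u with P? (length p)
  ... | yes Pp = Pp
  ... | no ¬Pp = P-K (length p) ((p , u , refl) , λ τ uτ → ≮⇒≥ λ τ<p →
                   contradiction (upper (<⇒≤ τ<p) (go τ (rec τ<p) uτ)) ¬Pp)

^-*-swap : ∀ x m n → (x ℕ.^ m) ℕ.^ n ≡ (x ℕ.^ n) ℕ.^ m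
^-*-swap x m n = trans (^-*-assoc x m n) (trans (cong (x ℕ.^_) (*-comm m n)) (sym (^-*-assoc x n m)))

^-distribʳ-* : ∀ x y n → (x ℕ.* y) ℕ.^ n ≡ x ℕ.^ n ℕ.* y ℕ.^ n
^-distribʳ-* x y zero    = refl
^-distribʳ-* x y (suc n) = trans (cong (x ℕ.* y ℕ.*_) (^-distribʳ-* x y n)) (rearrange x y (x ℕ.^ n) (y ℕ.^ n))
  where
  rearrange : ∀ x y u v → x ℕ.* y ℕ.* (u ℕ.* v) ≡ x ℕ.* u ℕ.* (y ℕ.* v)
  rearrange = solve-∀

m≤m^n : ∀ m n .{{_ : NonZero n}} → m ℕ.≤ m ℕ.^ n
m≤m^n zero      _       = z≤n
m≤m^n m@(suc _) (suc n) = m≤m*n m (m ℕ.^ n) {{m^n≢0 m n}}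

bracket : (g : ℕ → ℕ) → ∀ L n → L ℕ.< g n → L ℕ.< g 0 ⊎ ∃[ k ] g k ℕ.≤ L × L ℕ.< g (suc k)
bracket g L zero    L<g = inj₁ L<g
bracket g L (suc n) L<g with L <? g n
... | yes L<gn = bracket g L n L<gn
... | no  L≮gn = inj₂ (n , ≮⇒≥ L≮gn , L<g)

-- Here N is the length of a description of a window of length L; the hypothesis
-- on 2^(C k) is the complexity of the prefix of that length, bounded through the
-- machine, and the conclusion is the bound wanted for the window.
TransferBound : (a q₁ b q₂ C k₀ : ℕ) → Set
TransferBound a q₁ b q₂ C k₀ = ∀ c N k L → k₀ ℕ.≤ k → L ℕ.< 2 ℕ.^ Coding.window C (suc k) →
  (2 ℕ.^ (C ℕ.* k)) ℕ.^ b ℕ.≤ (N ℕ.+ (2 ℕ.+ C) ℕ.* k ℕ.+ c) ℕ.^ q₂ →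
  ∀ V → N ℕ.+ c ℕ.≤ V → 1 ℕ.≤ V → L ℕ.^ a ℕ.≤ V ℕ.^ q₁

-- C is chosen so large that C B exceeds (C + 1) A by q + 1; the factor
-- 2^((q + 1) k) gained this way absorbs the overhead (1 + F k)^q.
module Bounds (a q₁ b q₂ : ℕ) .{{_ : NonZero q₁}} .{{_ : NonZero q₂}} (aq₂<bq₁ : a ℕ.* q₂ ℕ.< b ℕ.* q₁) where

  A B q C D F E k₀ : ℕ
  A  = a ℕ.* q₂
  B  = b ℕ.* q₁
  q  = q₁ ℕ.* q₂
  C  = A ℕ.+ suc q
  D  = suc C
  F  = suc D
  E  = 2 ℕ.^ (suc D ℕ.* A)
  k₀ = E ℕ.* F ℕ.^ q

  open Coding C using (window)

  rate : D ℕ.* A ℕ.+ suc q ℕ.≤ C ℕ.* B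
  rate = ≤-trans (≤-reflexive (rearrange A (suc q))) (*-monoʳ-≤ C aq₂<bq₁)
    where
    rearrange : ∀ A s → suc (A ℕ.+ s) ℕ.* A ℕ.+ s ≡ (A ℕ.+ s) ℕ.* suc A
    rearrange = solve-∀

  transferBound : TransferBound a q₁ b q₂ C k₀
  transferBound c N k L k₀≤k L< lower V N+c≤V 1≤V = ≮⇒≥ λ V^q₁<L^a →
    <-irrefl refl (<-≤-trans (^-monoˡ-< q₂ V^q₁<L^a) powers)
    where
    X G : ℕ
    X = 2 ℕ.^ (D ℕ.* k ℕ.* A)
    G = F ℕ.^ q ℕ.* 2 ℕ.^ (k ℕ.* q)

    N+Fk+c≤ : N ℕ.+ F ℕ.* k ℕ.+ c ℕ.≤ V ℕ.* (F ℕ.* 2 ℕ.^ k)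
    N+Fk+c≤ = begin
      N ℕ.+ F ℕ.* k ℕ.+ c          ≡⟨ rearrange₁ N (F ℕ.* k) c ⟩
      N ℕ.+ c ℕ.+ F ℕ.* k          ≤⟨ +-mono-≤ N+c≤V (≤-trans (≤-reflexive (sym (*-identityˡ (F ℕ.* k)))) (*-monoˡ-≤ (F ℕ.* k) 1≤V)) ⟩
      V ℕ.+ V ℕ.* (F ℕ.* k)        ≤⟨ +-monoˡ-≤ _ (m≤m*n V F) ⟩
      V ℕ.* F ℕ.+ V ℕ.* (F ℕ.* k)  ≡⟨ rearrange₂ V F k ⟩
      V ℕ.* (F ℕ.* suc k)          ≤⟨ *-monoʳ-≤ V (*-monoʳ-≤ F (n<2^n k)) ⟩
      V ℕ.* (F ℕ.* 2 ℕ.^ k)        ∎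
      where
      rearrange₁ : ∀ x y z → x ℕ.+ y ℕ.+ z ≡ x ℕ.+ z ℕ.+ y
      rearrange₁ = solve-∀
      rearrange₂ : ∀ V F k → V ℕ.* F ℕ.+ V ℕ.* (F ℕ.* k) ≡ V ℕ.* (F ℕ.* suc k)
      rearrange₂ = solve-∀

    upper : 2 ℕ.^ (C ℕ.* B ℕ.* k) ℕ.≤ V ℕ.^ q ℕ.* G
    upper = begin
      2 ℕ.^ (C ℕ.* B ℕ.* k)                        ≡⟨ cong (2 ℕ.^_) (rearrange C b q₁ k) ⟩
      2 ℕ.^ (C ℕ.* k ℕ.* b ℕ.* q₁)                 ≡⟨ trans (cong (ℕ._^ q₁) (^-*-assoc 2 (C ℕ.* k) b)) (^-*-assoc 2 (C ℕ.* k ℕ.* b) q₁) ⟨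
      ((2 ℕ.^ (C ℕ.* k)) ℕ.^ b) ℕ.^ q₁             ≤⟨ ^-monoˡ-≤ q₁ lower ⟩
      ((N ℕ.+ F ℕ.* k ℕ.+ c) ℕ.^ q₂) ℕ.^ q₁        ≡⟨ trans (^-*-swap _ q₂ q₁) (^-*-assoc _ q₁ q₂) ⟩
      (N ℕ.+ F ℕ.* k ℕ.+ c) ℕ.^ q                  ≤⟨ ^-monoˡ-≤ q N+Fk+c≤ ⟩
      (V ℕ.* (F ℕ.* 2 ℕ.^ k)) ℕ.^ q                ≡⟨ trans (^-distribʳ-* V _ q) (cong (V ℕ.^ q ℕ.*_) (^-distribʳ-* F _ q)) ⟩
      V ℕ.^ q ℕ.* (F ℕ.^ q ℕ.* (2 ℕ.^ k) ℕ.^ q)    ≡⟨ cong (λ z → V ℕ.^ q ℕ.* (F ℕ.^ q ℕ.* z)) (^-*-assoc 2 k q) ⟩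
      V ℕ.^ q ℕ.* G                                ∎
      where
      rearrange : ∀ C b q k → C ℕ.* (b ℕ.* q) ℕ.* k ≡ C ℕ.* k ℕ.* b ℕ.* q
      rearrange = solve-∀

    L^A≤ : L ℕ.^ A ℕ.≤ X ℕ.* E
    L^A≤ = begin
      L ℕ.^ A                                ≤⟨ ^-monoˡ-≤ A (<⇒≤ L<) ⟩
      (2 ℕ.^ window (suc k)) ℕ.^ A           ≡⟨ ^-*-assoc 2 (window (suc k)) A ⟩
      2 ℕ.^ (window (suc k) ℕ.* A)           ≡⟨ cong (2 ℕ.^_) (rearrange D k A) ⟩
      2 ℕ.^ (D ℕ.* k ℕ.* A ℕ.+ suc D ℕ.* A)  ≡⟨ ^-distribˡ-+-* 2 (D ℕ.* k ℕ.* A) (suc D ℕ.* A) ⟩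
      X ℕ.* E                                ∎
      where
      rearrange : ∀ D k A → suc (D ℕ.* suc k) ℕ.* A ≡ D ℕ.* k ℕ.* A ℕ.+ suc D ℕ.* A
      rearrange = solve-∀

    L^A≤V^q : L ℕ.^ A ℕ.≤ V ℕ.^ q
    L^A≤V^q = *-cancelʳ-≤ (L ℕ.^ A) (V ℕ.^ q) G {{m*n≢0 (F ℕ.^ q) (2 ℕ.^ (k ℕ.* q)) {{m^n≢0 F q}} {{m^n≢0 2 (k ℕ.* q)}}}} (begin
      L ℕ.^ A ℕ.* G                                     ≤⟨ *-monoˡ-≤ G L^A≤ ⟩
      X ℕ.* E ℕ.* (F ℕ.^ q ℕ.* 2 ℕ.^ (k ℕ.* q))         ≡⟨ rearrange₁ X E (F ℕ.^ q) (2 ℕ.^ (k ℕ.* q)) ⟩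
      X ℕ.* (k₀ ℕ.* 2 ℕ.^ (k ℕ.* q))                    ≤⟨ *-monoʳ-≤ X (*-monoˡ-≤ (2 ℕ.^ (k ℕ.* q)) (≤-trans k₀≤k (<⇒≤ (n<2^n k)))) ⟩
      X ℕ.* (2 ℕ.^ k ℕ.* 2 ℕ.^ (k ℕ.* q))               ≡⟨ trans (^-distribˡ-+-* 2 (D ℕ.* k ℕ.* A) (k ℕ.+ k ℕ.* q)) (cong (X ℕ.*_) (^-distribˡ-+-* 2 k (k ℕ.* q))) ⟨
      2 ℕ.^ (D ℕ.* k ℕ.* A ℕ.+ (k ℕ.+ k ℕ.* q))         ≡⟨ cong (2 ℕ.^_) (rearrange₂ D k A q) ⟩
      2 ℕ.^ ((D ℕ.* A ℕ.+ suc q) ℕ.* k)                 ≤⟨ ^-monoʳ-≤ 2 (*-monoˡ-≤ k rate) ⟩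
      2 ℕ.^ (C ℕ.* B ℕ.* k)                             ≤⟨ upper ⟩
      V ℕ.^ q ℕ.* G                                     ∎)
      where
      rearrange₁ : ∀ X E F P → X ℕ.* E ℕ.* (F ℕ.* P) ≡ X ℕ.* (E ℕ.* F ℕ.* P)
      rearrange₁ = solve-∀
      rearrange₂ : ∀ D k A q → D ℕ.* k ℕ.* A ℕ.+ (k ℕ.+ k ℕ.* q) ≡ (D ℕ.* A ℕ.+ suc q) ℕ.* k
      rearrange₂ = solve-∀

    powers : (L ℕ.^ a) ℕ.^ q₂ ℕ.≤ (V ℕ.^ q₁) ℕ.^ q₂
    powers = begin
      (L ℕ.^ a) ℕ.^ q₂   ≡⟨ ^-*-assoc L a q₂ ⟩
      L ℕ.^ A            ≤⟨ L^A≤V^q ⟩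
      V ℕ.^ q            ≡⟨ ^-*-assoc V q₁ q₂ ⟨
      (V ℕ.^ q₁) ℕ.^ q₂  ∎

exponents : ∀ α β → 0ℚ < α → α < β → ℤ.∣ ↥ α ∣ ℕ.* ↧ₙ β ℕ.< ℤ.∣ ↥ β ∣ ℕ.* ↧ₙ α
exponents (mkℚ (+ a) _ _) (mkℚ (+ b) _ _) _ (*<* p) =
  ℤ.drop‿+<+ (subst₂ ℤ._<_ (sym (ℤ.pos-* a _)) (sym (ℤ.pos-* b _)) p)
exponents (mkℚ (+ a) _ _) (mkℚ ℤ.-[1+ b ] _ _) _ (*<* p) = contradiction p (ℤ.≤⇒≯ (ℤ.≤-trans ℤ.-≤+ (ℤ.≤-reflexive (ℤ.pos-* a _))))
exponents (mkℚ ℤ.-[1+ _ ] _ _) _ (*<* ()) _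

module Transfer {U : Machine} (universal : Universal U) (a q₁ b q₂ : ℕ) .{{_ : NonZero q₁}} .{{_ : NonZero q₂}}
  (C k₀ : ℕ) (bound : TransferBound a q₁ b q₂ C k₀)
  (Z : ℕ → Bool) (c : ℕ) (complex : ∀ n → K[ U , Z ↾ n ]≥ (root q₂ (n ℕ.^ b) -ℝ ι c)) where

  open Coding C

  W : ℕ → Bool
  W n = Z (⟦ positionᴾ ⟧ (n ∷ []))

  simulation : ∃[ ρ ] ∀ τ σ → (U ⟨ ρ ++ τ ⟩≃ σ) ⇔ (machine U ⟨ τ ⟩≃ σ)
  simulation = Universal.universal universal (machine U) (machine-prefixFree (Universal.prefixFree universal))

  ρ : List Bool
  ρ = proj₁ simulation

  c₁ c₂ : ℕ
  c₁ = length ρ ℕ.+ c ℕ.+ 3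
  c₂ = c₁ ℕ.+ (2 ℕ.^ window k₀) ℕ.^ a

  length-header : ∀ k w p → length w ≡ window k →
    suc (length (ρ ++ header k w p) ℕ.+ c) ≡ length p ℕ.+ (2 ℕ.+ C) ℕ.* k ℕ.+ c₁
  length-header k w p eq = trans
    (cong (λ l → suc (l ℕ.+ c)) (trans (length-++ ρ) (cong (length ρ ℕ.+_) (trans (length-++ (replicate k false))
      (cong₂ (λ x y → x ℕ.+ suc y) (length-replicate k) (trans (length-++ w) (cong (ℕ._+ length p) eq)))))))
    (rearrange (length ρ) k (suc C) (length p) c)
    where
    rearrange : ∀ r k D p c → suc (r ℕ.+ (k ℕ.+ suc (suc (D ℕ.* k) ℕ.+ p)) ℕ.+ c) ≡ p ℕ.+ suc D ℕ.* k ℕ.+ (r ℕ.+ c ℕ.+ 3)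
    rearrange = solve-∀

  prefix-bound : ∀ n p → U ⟨ p ⟩≃ Z ↾ n → n ℕ.^ b ℕ.≤ suc (length p ℕ.+ c) ℕ.^ q₂
  prefix-bound n = K-bounds-descriptions U (Z ↾ n) {λ l → n ℕ.^ b ℕ.≤ suc (l ℕ.+ c) ℕ.^ q₂}
    (λ l → n ℕ.^ b ≤? suc (l ℕ.+ c) ℕ.^ q₂)
    (λ k≤l P → ≤-trans P (^-monoˡ-≤ (q₂) (s≤s (+-monoˡ-≤ c k≤l))))
    (λ k Kk → root≤⁻¹ (q₂) (n ℕ.^ b) c k (complex n k Kk))

  short-bound : ∀ L N → L ℕ.< 2 ℕ.^ window k₀ → L ℕ.^ a ℕ.≤ (N ℕ.+ c₂) ℕ.^ q₁
  short-bound L N L<P = ≤-trans (^-monoˡ-≤ a (<⇒≤ L<P)) (≤-trans (m≤n+m ((2 ℕ.^ window k₀) ℕ.^ a) c₁)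
    (≤-trans (m≤n+m c₂ N) (m≤m^n (N ℕ.+ c₂) q₁)))

  long-bound : ∀ i L p k → k₀ ℕ.≤ k → 2 ℕ.^ window k ℕ.≤ L → L ℕ.< 2 ℕ.^ window (suc k) →
    U ⟨ p ⟩≃ (λ j → W (i ℕ.+ j)) ↾ L → L ℕ.^ a ℕ.≤ (length p ℕ.+ c₂) ℕ.^ q₁
  long-bound i L p k k₀≤k P≤L L<P′ u =
    let w , length≡ , computes = machine-computes {U} Z i k P≤L in
    bound c₁ (length p) k L k₀≤k L<P′
      (subst (λ l → (2 ℕ.^ (C ℕ.* k)) ℕ.^ b ℕ.≤ l ℕ.^ q₂) (length-header k w p length≡)
        (prefix-bound (2 ℕ.^ (C ℕ.* k)) (ρ ++ header k w p)
          (Equivalence.from (proj₂ simulation (header k w p) (Z ↾ 2 ℕ.^ (C ℕ.* k))) (computes p u))))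
      (length p ℕ.+ c₂)
      (+-monoʳ-≤ (length p) (m≤m+n c₁ _))
      (≤-trans (≤-trans (s≤s z≤n) (m≤n+m 3 (length ρ ℕ.+ c))) (≤-trans (m≤m+n c₁ _) (m≤n+m c₂ (length p))))

  substring-bound : ∀ i L p → U ⟨ p ⟩≃ (λ j → W (i ℕ.+ j)) ↾ L → L ℕ.^ a ℕ.≤ (length p ℕ.+ c₂) ℕ.^ q₁
  substring-bound i L p u = [ short-bound L (length p)
    , (λ (d , P≤L , L<P′) → long-bound i L p (d ℕ.+ k₀) (m≤n+m k₀ d) P≤L L<P′ u) ]′
    (bracket (λ d → 2 ℕ.^ window (d ℕ.+ k₀)) L L
      (<-≤-trans (n<2^n L) (^-monoʳ-≤ 2 (≤-trans (m≤m+n L k₀) (≤-trans (m≤n*m (L ℕ.+ k₀) (suc C)) (n≤1+n _))))))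

  window-complex : W ∈ SC U (λ n → root q₁ (n ℕ.^ a))
  window-complex = c₂ , λ where
    τ (i , τ≡) l ((p , u , refl) , _) → root≤ q₁ (length τ ℕ.^ a) c₂ l
      (substring-bound i (length τ) p (subst (U ⟨ p ⟩≃_) τ≡ u))

transfer : ∀ {U} → Universal U → ∀ a q₁ b q₂ .{{_ : NonZero q₁}} .{{_ : NonZero q₂}} → a ℕ.* q₂ ℕ.< b ℕ.* q₁ →
  asBaire (SC U (λ n → root q₁ (n ℕ.^ a))) ≤ₛ asBaire (COMPLEX U (λ n → root q₂ (n ℕ.^ b)))
transfer universal a q₁ b q₂ aq₂<bq₁ = comp (oracle zero) (compile positionᴾ ∷ []) , λ where
    X (Z , X≡Z , c , complex) →
      (λ n → X (⟦ positionᴾ ⟧ (n ∷ []))) ,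
      (λ n → comp (compile-computes positionᴾ (n ∷ []) ∷ []) (oracle zero)) ,
      (λ n → Z (⟦ positionᴾ ⟧ (n ∷ []))) ,
      (λ n → X≡Z (⟦ positionᴾ ⟧ (n ∷ []))) ,
      Transfer.window-complex universal a q₁ b q₂ C k₀ transferBound Z c complex
  where
  open Bounds a q₁ b q₂ aq₂<bq₁ using (C; k₀; transferBound)
  open Coding C using (positionᴾ)

mainTheorem16 : (U : Machine) → Universal U →
    (α β : ℚ) (0<α : 0ℚ < α) (α<β : α < β) → β ≤ 1ℚ →
    asBaire (SC U (λ n → n ^ᵠ α [ 0<α ])) ≤ₛ asBaire (COMPLEX U (λ n → n ^ᵠ β [ <-trans 0<α α<β ]))
mainTheorem16 U universal α β 0<α α<β _ =
  transfer universal ℤ.∣ ↥ α ∣ (↧ₙ α) ℤ.∣ ↥ β ∣ (↧ₙ β) (exponents α β 0<α α<β)
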